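{- Let $\Delta$ be a non-pure shellable simplicial complex of dimension less than $n$, with $h$-triangle entries $h_{k,i}$. Then the $\mathbf{cd}$-index of the semisuspension of $\Delta$ is given by $$\Psi(\mathrm{Semi}(\Delta,n))=\sum_{k=0}^{n}\sum_{i=0}^{k}h_{k,i}\cdot\check\Phi(n,k,i).$$
   Context: A quasi-graded poset $(P,\rho,\bar\zeta)$ consists of a finite poset $P$, a function $\rho:P\to\mathbb N$ with $x<y\Rightarrow\rho(x)<\rho(y)$, and a function $\bar\zeta$ in the incidence algebra of $P$ with $\bar\zeta(x,x)=1$. Write $\rho(x,y)=\rho(y)-\rho(x)$. If $P$ has minimal element $\hat0$ and maximal element $\hat1$, $\hat0<\hat1$, its $\mathbf{ab}$-index is the polynomial in non-commuting variables $\mathbf a,\mathbf b$ $$\Psi(P)=\sum\bar\zeta(x_0,x_1)\cdots\bar\zeta(x_{k-1},x_k)\cdot(\mathbf a-\mathbf b)^{\rho(x_0,x_1)-1}\,\mathbf b\,(\mathbf a-\mathbf b)^{\rho(x_1,x_2)-1}\,\mathbf b\cdots\mathbf b\,(\mathbf a-\mathbf b)^{\rho(x_{k-1},x_k)-1},$$ summed over all chains $\hat0=x_0<x_1<\cdots<x_k=\hat1$. For the posets here it is a polynomial in $\mathbf c=\mathbf a+\mathbf b$, $\mathbf d=\mathbf a\mathbf b+\mathbf b\mathbf a$ and is then called the $\mathbf{cd}$-index. Semisuspension. For $n\ge1$ and a finite simplicial complex $\Delta$ (containing $\emptyset$) with $\dim\Delta<n$, $\mathrm{Semi}(\Delta,n)$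 is obtained by embedding $\Delta$ in the boundary of an $n$-ball, and $\Psi(\mathrm{Semi}(\Delta,n))$ is the $\mathbf{ab}$-index of its face poset $\mathcal F(\mathrm{Semi}(\Delta,n))$, which is the following quasi-graded poset, independent of the embedding: the elements are the faces of $\Delta$ (with $\hat0=\emptyset$) and two further elements $*$ and $\hat1$; $\rho(F)=\dim F+1$, $\rho(*)=n$, $\rho(\hat1)=n+1$; faces are ordered by inclusion, every other element is $<\hat1$, and $F<*$ for every face $F$ with $\rho(F)<n$ (faces of dimension $n-1$ are incomparable to $*$); $$\bar\zeta(F,*)=1+(-1)^{n-\rho(F)}\,\widetilde\chi(\mathrm{link}_\Delta(F)),\qquad\widetilde\chi(\mathrm{link}_\Delta(F))=\sum_{H\in\Delta,\,H\supseteq F}(-1)^{\dim H-\dim F-1},$$ and $\bar\zeta=1$ on all other intervals. Shelling components. For $0\le i\le k$, $\Delta_{k,i}$ is the simplicial complex generated by $i+1$ of the facets of the $k$-dimensional simplex (so $\dim\Delta_{k,i}=k-1$, and $\Delta_{0,0}=\{\emptyset\}$). For $0\le i\le k\le n$ let $P_{n,k,i}=\mathcal F(\mathrm{Semi}(\Delta_{k,i},n))$, and define $\check\Phi(n,k,0)=\Psi(P_{n,k,0})$ and $\check\Phi(n,k,i)=\Psi(P_{n,k,i})-\Psi(P_{n,k,i-1})$ for $1\le i\le k\le n$. Shellability (Björner--Wachs). A finite simplicial complex $\Delta$, whose facets (maximal faces) need not have the same dimension, is non-pure shellable if $\dim\Delta=0$ (any ordering of the facets is a shelling order), or $\dim\Delta\ge1$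 and the facets can be ordered $F_1,\ldots,F_m$ (a shelling order) so that for $r=2,\ldots,m$ the complex $\big(\bigcup_{j=1}^{r-1}\overline{F_j}\big)\cap\overline{F_r}$ is pure of dimension $\dim(F_r)-1$, where $\overline F$ is the complex of all faces of $F$. The facet $F_r$ has shelling type $(k,i)$ if $\dim(F_r)+1=k$ and $\big(\bigcup_{j=1}^{r-1}\overline{F_j}\big)\cap\overline{F_r}$ has $i$ facets (of dimension $k-2$); the first facet $F_1$ has type $(\dim(F_1)+1,0)$. $h_{k,i}$ is the number of facets of shelling type $(k,i)$ in a shelling order; it is known not to depend on the shelling order. -}

module Defs where

open import Data.Bool using (if_then_else_)
open import Data.Fin using (Fin; zero; suc; toℕ; inject₁; inject≤)
import Data.Fin.Properties as Fin
open import Data.Fin.Subset using (Subset; inside; outside; _⊆_; _⊂_; ⊥; ∁; ⁅_⁆; ∣_∣)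
import Data.Fin.Subset.Properties as Sub
open import Data.Integer as ℤ using (ℤ; +_; 0ℤ; 1ℤ; -1ℤ)
import Data.Integer.Properties as ℤ
open import Data.Irrelevant using ([_])
open import Data.List using (List; []; _∷_; _++_; map; concatMap; filter; foldr; length; lookup; take; allFin; upTo; cartesianProductWith)
import Data.List.Properties as List
open import Data.List.Extrema.Nat using (max; max≤v⁺; xs≤max)
open import Data.List.Membership.Propositional using (_∈_)
open import Data.List.Membership.Propositional.Properties using (∈-++⁺ˡ; ∈-++⁺ʳ; ∈-map⁺; ∈-map⁻; ∈-filter⁺; ∈-filter⁻)
import Data.List.Relation.Unary.All as All
import Data.List.Relation.Unary.All.Properties as All
open import Data.List.Relation.Unary.AllPairs using ([]; _∷_)
open import Data.List.Relation.Unary.Any using (Any; here; there; any?)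
open import Data.List.Relation.Unary.Unique.Propositional using (Unique)
import Data.List.Relation.Unary.Unique.Propositional.Properties as Unique
open import Data.Nat using (ℕ; zero; suc; _∸_; _≤_; _<_; z≤n; s≤s)
import Data.Nat.Properties as ℕ
open import Data.Product using (_×_; _,_; ∃; proj₂)
open import Data.Product.Properties using () renaming (≡-dec to ×-≡-dec)
open import Data.Refinement using (Refinement; Refinement-syntax; value-injective) renaming (_,_ to _,ᵣ_; _≟_ to ≟ᵣ)
open Refinement using (value)
open import Data.Sum using (_⊎_)
open import Data.Vec using ([]; _∷_)
import Data.Vec.Properties as Vec
import Data.Bool.Properties as Bool
open import Function using (_∘_; _⇔_)
open import Level using (0ℓ)
open import Relation.Binary using (IsDecPartialOrder; Minimum; Maximum; DecidableEquality)
import Relation.Binary as B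
open import Relation.Binary.Construct.NonStrictToStrict using (<-decidable)
open import Relation.Binary.PropositionalEquality using (_≡_; _≢_; refl; sym; trans; cong; subst; isEquivalence)
open import Relation.Nullary using (yes; no; does; ¬_; ¬?; _×-dec_; recompute; contradiction)
open import Relation.Nullary.Decidable using (dec-true; dec-false; decidable-stable; map′)
open import Relation.Unary using (Pred; Decidable)

data Letter : Set where
  𝐚 𝐛 : Letter

_≟ᴸ_ : DecidableEquality Letter
𝐚 ≟ᴸ 𝐚 = yes refl
𝐚 ≟ᴸ 𝐛 = no λ ()
𝐛 ≟ᴸ 𝐚 = no λ ()
𝐛 ≟ᴸ 𝐛 = yes refl

Word : Set
Word = List Letter

-- A polynomial is an unreduced formal sum of terms (coefficient , word); two
-- such sums are identified by _≈_ when all their collected coefficients agree.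
Poly : Set
Poly = List (ℤ × Word)

coeff : Poly → Word → ℤ
coeff []            w = 0ℤ
coeff ((c , u) ∷ p) w =
  (if does (List.≡-dec _≟ᴸ_ u w) then c else 0ℤ) ℤ.+ coeff p w

infix 4 _≈_
_≈_ : Poly → Poly → Set
p ≈ q = ∀ w → coeff p w ≡ coeff q w

infixl 6 _+ᵖ_ _-ᵖ_
infixl 7 _*ᵖ_
infixr 7 _·_
infixr 8 _^ᵖ_

0ᵖ 1ᵖ a b : Poly
0ᵖ = []
1ᵖ = (1ℤ , []) ∷ []
a  = (1ℤ , 𝐚 ∷ []) ∷ []
b  = (1ℤ , 𝐛 ∷ []) ∷ []

_+ᵖ_ : Poly → Poly → Poly
_+ᵖ_ = _++_

_·_ : ℤ → Poly → Poly
c · p = map (λ (d , u) → c ℤ.* d , u) p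

_-ᵖ_ : Poly → Poly → Poly
p -ᵖ q = p +ᵖ -1ℤ · q

_*ᵖ_ : Poly → Poly → Poly
_*ᵖ_ = cartesianProductWith (λ (c , u) (d , w) → c ℤ.* d , u ++ w)

_^ᵖ_ : Poly → ℕ → Poly
p ^ᵖ zero  = 1ᵖ
p ^ᵖ suc k = p *ᵖ p ^ᵖ k

sumᵖ : List Poly → Poly
sumᵖ = foldr _+ᵖ_ 0ᵖ

record QuasiGradedPoset : Set₁ where
  infix 4 _≼_ _≺_ _≺?_
  field
    Carrier           : Set
    _≼_               : Carrier → Carrier → Set
    isDecPartialOrder : IsDecPartialOrder _≡_ _≼_
    elements          : List Carrier
    elements-unique   : Unique elements
    elements-complete : ∀ x → x ∈ elements

  open IsDecPartialOrder isDecPartialOrder public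
    using (_≟_) renaming (_≤?_ to _≼?_)

  _≺_ : Carrier → Carrier → Set
  x ≺ y = x ≼ y × x ≢ y

  _≺?_ : B.Decidable _≺_
  _≺?_ = <-decidable _≡_ _≼_ _≟_ _≼?_

  -- An element of the incidence algebra is a function on the pairs x ≼ y,
  -- here extended by zero to all pairs.
  field
    ρ       : Carrier → ℕ
    ρ-mono  : ∀ {x y} → x ≺ y → ρ x < ρ y
    ζ̄       : Carrier → Carrier → ℤ
    ζ̄-supp  : ∀ {x y} → ¬ x ≼ y → ζ̄ x y ≡ 0ℤ
    ζ̄-refl  : ∀ x → ζ̄ x x ≡ 1ℤ

record Bounded (P : QuasiGradedPoset) : Set where
  open QuasiGradedPoset P
  field
    0̂ 1̂     : Carrier
    minimum : Minimum _≼_ 0̂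
    maximum : Maximum _≼_ 1̂
    0̂≺1̂     : 0̂ ≺ 1̂

module _ (P : QuasiGradedPoset) (P-bounded : Bounded P) where
  open QuasiGradedPoset P
  open Bounded P-bounded

  -- chains k x lists all (x₁ , … , x_k) with x ≺ x₁ ≺ ⋯ ≺ x_k ≺ 1̂.
  chains : ℕ → Carrier → List (List Carrier)
  chains zero    x = if does (x ≺? 1̂) then [] ∷ [] else []
  chains (suc k) x =
    concatMap (λ y → map (y ∷_) (chains k y)) (filter (x ≺?_) elements)

  ζ̄-product : Carrier → List Carrier → ℤ
  ζ̄-product x []       = ζ̄ x 1̂
  ζ̄-product x (y ∷ ys) = ζ̄ x y ℤ.* ζ̄-product y ys

  -- The exponent ρ(x,y) - 1 is never truncated, since ρ x < ρ y along a chain.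
  ab-product : Carrier → List Carrier → Poly
  ab-product x []       = (a -ᵖ b) ^ᵖ (ρ 1̂ ∸ ρ x ∸ 1)
  ab-product x (y ∷ ys) = (a -ᵖ b) ^ᵖ (ρ y ∸ ρ x ∸ 1) *ᵖ b *ᵖ ab-product y ys

  -- A chain between 0̂ and 1̂ has fewer than length elements interior points,
  -- so the sum below ranges over all chains.
  Ψ : Poly
  Ψ = sumᵖ (map (λ xs → ζ̄-product 0̂ xs · ab-product 0̂ xs)
                (concatMap (λ k → chains k 0̂) (upTo (length elements))))

subsets : ∀ v → List (Subset v)
subsets zero    = [] ∷ []
subsets (suc v) = map (outside ∷_) (subsets v) ++ map (inside ∷_) (subsets v)

∈-subsets : ∀ {v} (p : Subset v) → p ∈ subsets v
∈-subsets []            = here refl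
∈-subsets (outside ∷ p) = ∈-++⁺ˡ (∈-map⁺ (outside ∷_) (∈-subsets p))
∈-subsets (inside ∷ p)  = ∈-++⁺ʳ _ (∈-map⁺ (inside ∷_) (∈-subsets p))

subsets-unique : ∀ v → Unique (subsets v)
subsets-unique zero    = All.[] ∷ []
subsets-unique (suc v) =
  Unique.++⁺ (Unique.map⁺ Vec.∷-injectiveʳ (subsets-unique v))
             (Unique.map⁺ Vec.∷-injectiveʳ (subsets-unique v))
             disjoint
  where
  disjoint : ∀ {x} → ¬ (x ∈ map (outside ∷_) (subsets v) ×
                        x ∈ map (inside ∷_) (subsets v))
  disjoint (p , q) with ∈-map⁻ (outside ∷_) p | ∈-map⁻ (inside ∷_) q
  ... | _ , _ , refl | _ , _ , ()

⊆∧size⇒≡ : ∀ {v} {p q : Subset v} → p ⊆ q → ∣ p ∣ ≡ ∣ q ∣ → p ≡ q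
⊆∧size⇒≡ {p = p} {q} p⊆q eq =
  Sub.⊆-antisym p⊆q λ {x} x∈q → decidable-stable (x Sub.∈? p) λ x∉p →
    ℕ.<⇒≢ (Sub.p⊂q⇒∣p∣<∣q∣ (p⊆q , x , x∈q , x∉p)) eq

-- The vertex set is a subset of Fin v: not every singleton has to be a face.
record SimplicialComplex (v : ℕ) : Set₁ where
  field
    Face        : Pred (Subset v) 0ℓ
    Face?       : Decidable Face
    ∅-face      : Face ⊥
    down-closed : ∀ {F G} → F ⊆ G → Face G → Face F

  faces : List (Subset v)
  faces = filter Face? (subsets v)

open SimplicialComplex

dimF : ∀ {v} → Subset v → ℤ
dimF F = + ∣ F ∣ ℤ.- 1ℤ

dim : ∀ {v} → SimplicialComplex v → ℤ
dim Δ = + max 0 (map ∣_∣ (faces Δ)) ℤ.- 1ℤ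

module _ {v : ℕ} where

  Maximal : Pred (Subset v) 0ℓ → Pred (Subset v) 0ℓ
  Maximal 𝓕 F = 𝓕 F × ¬ (∃ λ G → 𝓕 G × F ⊂ G)

  Maximal? : ∀ {𝓕} → Decidable 𝓕 → Decidable (Maximal 𝓕)
  Maximal? 𝓕? F =
    𝓕? F ×-dec ¬? (Sub.anySubset? (λ G → 𝓕? G ×-dec (F Sub.⊂? G)))

  Pure : Pred (Subset v) 0ℓ → ℤ → Set
  Pure 𝓕 d = ∀ F → Maximal 𝓕 F → dimF F ≡ d

generated : ∀ {v m} → (Fin (suc m) → Subset v) → SimplicialComplex v
generated F = record
  { Face        = λ G → ∃ λ j → G ⊆ F j
  ; Face?       = λ G → Fin.any? (λ j → G Sub.⊆? F j)
  ; ∅-face      = zero , Sub.⊆-min _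
  ; down-closed = λ G⊆H (j , H⊆Fj) → j , Sub.⊆-trans G⊆H H⊆Fj
  }

-- Δ_{k,i}: the simplex has vertex set Fin (suc k), and the chosen facets are
-- the ones opposite the vertices 0 , … , i.
component : (k : ℕ) → Fin (suc k) → SimplicialComplex (suc k)
component k i = generated {m = toℕ i} (λ j → ∁ ⁅ inject≤ j (Fin.toℕ<n i) ⁆)

module _ {v : ℕ} (Fs : List (Subset v)) (r : Fin (length Fs)) where

  -- The faces of (⋃_{j<r} F̄_j) ∩ F̄_r.
  Attaching : Pred (Subset v) 0ℓ
  Attaching G = Any (G ⊆_) (take (toℕ r) Fs) × G ⊆ lookup Fs r

  Attaching? : Decidable Attaching
  Attaching? G = any? (G Sub.⊆?_) (take (toℕ r) Fs) ×-dec (G Sub.⊆? lookup Fs r)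

  -- For the first facet Attaching is empty, giving (dim F₁ + 1 , 0).
  shellingType : ℕ × ℕ
  shellingType =
    ∣ lookup Fs r ∣ , length (filter (Maximal? Attaching?) (subsets v))

record IsShellingOrder {v} (Δ : SimplicialComplex v) (Fs : List (Subset v)) : Set where
  field
    distinct : Unique Fs
    facets   : ∀ F → F ∈ Fs ⇔ Maximal (Face Δ) F
    shelling : dim Δ ≡ 0ℤ
             ⊎ (1ℤ ℤ.≤ dim Δ ×
                (∀ (r : Fin (length Fs)) → 1 ≤ toℕ r →
                 Pure (Attaching Fs r) (dimF (lookup Fs r) ℤ.- 1ℤ)))

h : ∀ {v} → List (Subset v) → ℕ → ℕ → ℕ
h Fs k i =
  length (filter (λ r → ×-≡-dec ℕ._≟_ ℕ._≟_ (shellingType Fs r) (k , i))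
                 (allFin (length Fs)))

-- |H| - |F| + 1 has the parity of dim H - dim F - 1 and is nonnegative.
χ̃-link : ∀ {v} → SimplicialComplex v → Subset v → ℤ
χ̃-link Δ F =
  foldr ℤ._+_ 0ℤ
    (map (λ H → -1ℤ ℤ.^ suc (∣ H ∣ ∸ ∣ F ∣)) (filter (F Sub.⊆?_) (faces Δ)))

pred<⇒≤ : ∀ m {n} → + m ℤ.- 1ℤ ℤ.< + n → m ≤ n
pred<⇒≤ zero    _ = z≤n
pred<⇒≤ (suc m) p = ℤ.drop‿+<+ p

≤⇒pred< : ∀ {m n} → m ≤ n → + m ℤ.- 1ℤ ℤ.< + n
≤⇒pred< {zero}  _ = ℤ.-<+
≤⇒pred< {suc m} p = ℤ.+<+ p

face-size : ∀ {v n} (Δ : SimplicialComplex v) → dim Δ ℤ.< + n →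
            ∀ {F} → .(Face Δ F) → ∣ F ∣ ≤ n
face-size Δ dim<n {F} F∈Δ =
  ℕ.≤-trans (All.lookup (xs≤max 0 sizes) (∈-map⁺ ∣_∣ F∈faces))
            (pred<⇒≤ (max 0 sizes) dim<n)
  where
  sizes = map ∣_∣ (faces Δ)
  F∈faces : F ∈ faces Δ
  F∈faces = ∈-filter⁺ (Face? Δ) (∈-subsets F) (recompute (Face? Δ F) F∈Δ)

dim< : ∀ {v n} (Δ : SimplicialComplex v) →
       (∀ F → Face Δ F → ∣ F ∣ ≤ n) → dim Δ ℤ.< + n
dim< Δ bound = ≤⇒pred< (max≤v⁺ z≤n (All.map⁺ (All.tabulate λ F∈ →
  bound _ (proj₂ (∈-filter⁻ (Face? Δ) {xs = subsets _} F∈)))))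

module _ {v : ℕ} (Δ : SimplicialComplex v) where

  FaceOf : Set
  FaceOf = [ F ∈ Subset v ∣ Face Δ F ]

  restrict : List (Subset v) → List FaceOf
  restrict []       = []
  restrict (F ∷ Fs) with Face? Δ F
  ... | yes F∈Δ = (F ,ᵣ [ F∈Δ ]) ∷ restrict Fs
  ... | no  _   = restrict Fs

  map-value-restrict : ∀ Fs → map value (restrict Fs) ≡ filter (Face? Δ) Fs
  map-value-restrict []       = refl
  map-value-restrict (F ∷ Fs) with Face? Δ F
  ... | yes _ = cong (F ∷_) (map-value-restrict Fs)
  ... | no  _ = map-value-restrict Fs

  allFaces : List FaceOf
  allFaces = restrict (subsets v)

  allFaces-unique : Unique allFaces
  allFaces-unique = Unique.map⁻ (subst Unique (sym (map-value-restrict (subsets v)))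
                                  (Unique.filter⁺ (Face? Δ) (subsets-unique v)))

  allFaces-complete : ∀ F → F ∈ allFaces
  allFaces-complete F@(p ,ᵣ [ p∈Δ ])
    with ∈-map⁻ value (subst (p ∈_) (sym (map-value-restrict (subsets v)))
           (∈-filter⁺ (Face? Δ) (∈-subsets p) (recompute (Face? Δ p) p∈Δ)))
  ... | G , G∈ , p≡G = subst (_∈ allFaces) (value-injective (sym p≡G)) G∈

module Semisuspension {v : ℕ} (Δ : SimplicialComplex v) (n : ℕ) where

  data Element : Set where
    face : FaceOf Δ → Element
    *    : Element
    1̂    : Element

  infix 4 _≤ˢ_
  data _≤ˢ_ : Element → Element → Set where
    face≤face : ∀ {F G} → value F ⊆ value G → face F ≤ˢ face G
    face≤*    : ∀ {F} → ∣ value F ∣ < n → face F ≤ˢ *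
    *≤*       : * ≤ˢ *
    ≤1̂        : ∀ {x} → x ≤ˢ 1̂

  ≤ˢ-refl : ∀ {x} → x ≤ˢ x
  ≤ˢ-refl {face F} = face≤face Sub.⊆-refl
  ≤ˢ-refl {*}      = *≤*
  ≤ˢ-refl {1̂}      = ≤1̂

  ≤ˢ-trans : ∀ {x y z} → x ≤ˢ y → y ≤ˢ z → x ≤ˢ z
  ≤ˢ-trans (face≤face p) (face≤face q) = face≤face (Sub.⊆-trans p q)
  ≤ˢ-trans (face≤face p) (face≤* q)    =
    face≤* (ℕ.≤-<-trans (Sub.p⊆q⇒∣p∣≤∣q∣ p) q)
  ≤ˢ-trans (face≤* p)    *≤*           = face≤* p
  ≤ˢ-trans *≤*           q             = q
  ≤ˢ-trans _             ≤1̂            = ≤1̂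

  ≤ˢ-antisym : ∀ {x y} → x ≤ˢ y → y ≤ˢ x → x ≡ y
  ≤ˢ-antisym (face≤face p) (face≤face q) =
    cong face (value-injective (Sub.⊆-antisym p q))
  ≤ˢ-antisym *≤* _   = refl
  ≤ˢ-antisym ≤1̂  ≤1̂  = refl

  infix 4 _≟ˢ_ _≤ˢ?_
  _≟ˢ_ : DecidableEquality Element
  face F ≟ˢ face G = map′ (cong face) (λ { refl → refl })
                          (≟ᵣ (Vec.≡-dec Bool._≟_) F G)
  face _ ≟ˢ *      = no λ ()
  face _ ≟ˢ 1̂      = no λ ()
  *      ≟ˢ face _ = no λ ()
  *      ≟ˢ *      = yes refl
  *      ≟ˢ 1̂      = no λ ()
  1̂      ≟ˢ face _ = no λ ()
  1̂      ≟ˢ *      = no λ ()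
  1̂      ≟ˢ 1̂      = yes refl

  _≤ˢ?_ : B.Decidable _≤ˢ_
  face F ≤ˢ? face G = map′ face≤face (λ { (face≤face p) → p }) (value F Sub.⊆? value G)
  face F ≤ˢ? *      = map′ face≤* (λ { (face≤* p) → p }) (∣ value F ∣ ℕ.<? n)
  *      ≤ˢ? face _ = no λ ()
  *      ≤ˢ? *      = yes *≤*
  1̂      ≤ˢ? face _ = no λ ()
  1̂      ≤ˢ? *      = no λ ()
  _      ≤ˢ? 1̂      = yes ≤1̂

  isDecPartialOrderˢ : IsDecPartialOrder _≡_ _≤ˢ_
  isDecPartialOrderˢ = record
    { isPartialOrder = record
      { isPreorder = record
        { isEquivalence = isEquivalence
        ; reflexive     = λ { refl → ≤ˢ-refl }
        ; trans         = ≤ˢ-trans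
        }
      ; antisym = ≤ˢ-antisym
      }
    ; _≟_  = _≟ˢ_
    ; _≤?_ = _≤ˢ?_
    }

  elementsˢ : List Element
  elementsˢ = * ∷ 1̂ ∷ map face (allFaces Δ)

  face-injective : ∀ {F G} → face F ≡ face G → F ≡ G
  face-injective refl = refl

  elementsˢ-unique : Unique elementsˢ
  elementsˢ-unique =
    ((λ ()) All.∷ All.map⁺ (All.universal (λ _ ()) _)) ∷
    All.map⁺ (All.universal (λ _ ()) _) ∷
    Unique.map⁺ face-injective (allFaces-unique Δ)

  elementsˢ-complete : ∀ x → x ∈ elementsˢ
  elementsˢ-complete (face F) = there (there (∈-map⁺ face (allFaces-complete Δ F)))
  elementsˢ-complete *        = here refl
  elementsˢ-complete 1̂        = there (here refl)

  ρˢ : Element → ℕ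
  ρˢ (face F) = ∣ value F ∣
  ρˢ *        = n
  ρˢ 1̂        = suc n

  ρˢ-mono : dim Δ ℤ.< + n → ∀ {x y} → x ≤ˢ y × x ≢ y → ρˢ x < ρˢ y
  ρˢ-mono dim<n (face≤face {F} {G} p , F≢G) =
    ℕ.≤∧≢⇒< (Sub.p⊆q⇒∣p∣≤∣q∣ p) (F≢G ∘ cong face ∘ value-injective ∘ ⊆∧size⇒≡ p)
  ρˢ-mono dim<n (face≤* p , _) = p
  ρˢ-mono dim<n (*≤* , *≢*)    = contradiction refl *≢*
  ρˢ-mono dim<n {face (F ,ᵣ [ F∈Δ ])} (≤1̂ , _) = s≤s (face-size Δ dim<n F∈Δ)
  ρˢ-mono dim<n {*} (≤1̂ , _)   = ℕ.n<1+n n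
  ρˢ-mono dim<n {1̂} (≤1̂ , ne)  = contradiction refl ne

  ζ-value : Element → Element → ℤ
  ζ-value (face F) * = 1ℤ ℤ.+ -1ℤ ℤ.^ (n ∸ ∣ value F ∣) ℤ.* χ̃-link Δ (value F)
  ζ-value _        _ = 1ℤ

  ζ̄ˢ : Element → Element → ℤ
  ζ̄ˢ x y = if does (x ≤ˢ? y) then ζ-value x y else 0ℤ

  ζ̄ˢ-supp : ∀ {x y} → ¬ x ≤ˢ y → ζ̄ˢ x y ≡ 0ℤ
  ζ̄ˢ-supp {x} {y} x≰y rewrite dec-false (x ≤ˢ? y) x≰y = refl

  ζ̄ˢ-refl : ∀ x → ζ̄ˢ x x ≡ 1ℤ
  ζ̄ˢ-refl (face F) rewrite dec-true (face F ≤ˢ? face F) ≤ˢ-refl = refl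
  ζ̄ˢ-refl *        = refl
  ζ̄ˢ-refl 1̂        = refl

  poset : dim Δ ℤ.< + n → QuasiGradedPoset
  poset dim<n = record
    { Carrier           = Element
    ; _≼_               = _≤ˢ_
    ; isDecPartialOrder = isDecPartialOrderˢ
    ; elements          = elementsˢ
    ; elements-unique   = elementsˢ-unique
    ; elements-complete = elementsˢ-complete
    ; ρ                 = ρˢ
    ; ρ-mono            = ρˢ-mono dim<n
    ; ζ̄                 = ζ̄ˢ
    ; ζ̄-supp            = ζ̄ˢ-supp
    ; ζ̄-refl            = ζ̄ˢ-refl
    }

  ∅ᶠ : Element
  ∅ᶠ = face (⊥ ,ᵣ [ ∅-face Δ ])

  ∅-minimum : 1 ≤ n → Minimum _≤ˢ_ ∅ᶠ
  ∅-minimum _   (face G) = face≤face (Sub.⊆-min _)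
  ∅-minimum 1≤n *        = face≤* (subst (_< n) (sym (Sub.∣⊥∣≡0 v)) 1≤n)
  ∅-minimum _   1̂        = ≤1̂

  bounded : (dim<n : dim Δ ℤ.< + n) → 1 ≤ n → Bounded (poset dim<n)
  bounded _ 1≤n = record
    { 0̂       = ∅ᶠ
    ; 1̂       = 1̂
    ; minimum = ∅-minimum 1≤n
    ; maximum = λ _ → ≤1̂
    ; 0̂≺1̂     = ≤1̂ , λ ()
    }

Ψ-Semi : ∀ {v} (Δ : SimplicialComplex v) (n : ℕ) → 1 ≤ n → dim Δ ℤ.< + n → Poly
Ψ-Semi Δ n 1≤n dim<n = Ψ (poset dim<n) (bounded dim<n 1≤n)
  where open Semisuspension Δ n

component-dim : ∀ {n k} (i : Fin (suc k)) → k ≤ n → dim (component k i) ℤ.< + n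
component-dim {n} {k} i k≤n = dim< (component k i) λ F (j , F⊆) →
  ℕ.≤-trans (Sub.p⊆q⇒∣p∣≤∣q∣ F⊆) (ℕ.≤-trans (ℕ.≤-reflexive (size (inject≤ j _))) k≤n)
  where
  size : ∀ x → ∣ ∁ ⁅ x ⁆ ∣ ≡ k
  size x = trans (Sub.∣∁p∣≡n∸∣p∣ ⁅ x ⁆) (cong (suc k ∸_) (Sub.∣⁅x⁆∣≡1 x))

Ψ-P : (n k : ℕ) → Fin (suc k) → 1 ≤ n → k ≤ n → Poly
Ψ-P n k i 1≤n k≤n = Ψ-Semi (component k i) n 1≤n (component-dim i k≤n)

Φ̌ : (n k : ℕ) → Fin (suc k) → 1 ≤ n → k ≤ n → Poly
Φ̌ n k zero    1≤n k≤n = Ψ-P n k zero 1≤n k≤n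
Φ̌ n k (suc i) 1≤n k≤n = Ψ-P n k (suc i) 1≤n k≤n -ᵖ Ψ-P n k (inject₁ i) 1≤n k≤n

Σ[0≤_] : (m : ℕ) → (Fin (suc m) → Poly) → Poly
Σ[0≤ m ] f = sumᵖ (map f (allFin (suc m)))

{-# OPTIONS --safe #-}

-- Ψ(Semi(Δ,n)) is linear in the f-vector of Δ: it equals Σ_{H∈Δ} γ_n(|H|) for
-- coefficients γ_n that do not depend on Δ.  Indeed, the chains from a face F to
-- 1̂ run through faces G ⊇ F and possibly end in *, and ζ̄(F,*) is a sum over the
-- faces containing F; by induction on the number of interior points each sum over
-- chains from F is a sum over the faces H ⊇ F of a term that depends on |F| and
-- |H| only, because F ⊆ G ⊆ H is a Boolean interval.
--
-- A facet of shelling type (k,i) adds to the preceding ones exactly the faces of a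
-- Boolean interval from a set of size i to a set of size k.  The same holds for
-- Δ_{k,i} over Δ_{k,i-1}, so the facet contributes precisely Φ̌(n,k,i).

module Submission where

open import Algebra.Properties.AbelianGroup using (∙-cancelʳ)
open import Data.Bool using (true; false; if_then_else_)
import Data.Bool.Properties as Bool
open import Data.Empty using (⊥-elim)
open import Data.Fin using (Fin; zero; suc; toℕ; inject₁; fromℕ<; inject≤)
import Data.Fin.Properties as Fin
open import Data.Fin.Properties using (toℕ≤pred[n])
open import Data.Fin.Subset using (Subset; inside; outside; _⊆_; ⊥; ∁; ⁅_⁆; _-_; ∣_∣)
  renaming (_∈_ to _∈ˢ_; _∉_ to _∉ˢ_)
import Data.Fin.Subset.Properties as Sub
open import Data.Integer as ℤ using (ℤ; +_; _+_; _*_; 0ℤ; 1ℤ; -1ℤ)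
import Data.Integer.Properties as ℤ
open import Data.Irrelevant using ([_])
open import Data.List using (List; []; _∷_; _++_; map; concatMap; filter; foldr; length;
  lookup; take; allFin; upTo)
open import Data.List.Membership.Propositional using (_∈_; find; lose)
open import Data.List.Membership.Propositional.Properties
  using (∈-map⁺; ∈-filter⁻; ∈-lookup; ∈-allFin)
import Data.List.Properties as List
import Data.List.Relation.Unary.All as All
open import Data.List.Relation.Unary.AllPairs using ([]; _∷_)
open import Data.List.Relation.Unary.Any as Any using (Any; here; there; any?)
import Data.List.Relation.Unary.Any.Properties as Any
open import Data.List.Relation.Unary.Unique.Propositional using (Unique)
import Data.List.Relation.Unary.Unique.Propositional.Properties as Unique
open import Data.Nat as ℕ using (ℕ; zero; suc; _∸_; _≤_; _<_; z≤n; s≤s)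
import Data.Nat.Properties as ℕ
open import Data.Product using (_×_; _,_; ∃; proj₁; proj₂)
open import Data.Product.Properties using () renaming (≡-dec to ×-≡-dec)
open import Data.Refinement using (Refinement)
open import Data.Sum using (_⊎_; inj₁; inj₂)
open import Data.Vec as Vec using ([]; _∷_)
import Data.Vec.Properties as Vec
open import Defs
open import Function using (_∘_; id; _⇔_; mk⇔; Equivalence)
open import Level using (Level; 0ℓ)
open import Relation.Binary using (IsDecPartialOrder)
open import Relation.Binary.PropositionalEquality
  using (_≡_; _≢_; refl; sym; trans; cong; cong₂; subst; module ≡-Reasoning)
open import Relation.Nullary using (Dec; yes; no; does; ¬_; contradiction; ¬?; _×-dec_)
open import Relation.Nullary.Decidable using (decidable-stable; does-⇔; dec-true; dec-false)
open import Relation.Unary using (Pred; Decidable)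
open Refinement using (value)
open ≡-Reasoning

-- `γ_n(t)` is `faceSeries n t`. Two features of the definitions obstruct its independence of the
-- complex. `Ψ` bounds the number of interior points by the number of elements, which varies with
-- the complex; since ranks increase along chains, the range can be replaced by `0, …, n`. And a
-- chain step from `F` distinguishes `G = F` from `G ≠ F`, as does the constant 1 in `ζ̄(F,*)`; for
-- `F ⊆ G` both are conditions on sizes.
--
-- The Boolean interval added by a facet `F` comes from purity: the maximal faces shared with the
-- preceding facets are the sets `F - x` for `x` in some `R ⊆ F`, so a face of `F` is new exactly
-- when it contains `R`, and `|R|` is the number `i` of the shelling type. In `Δ_{k,i}` the
-- corresponding set is that of the vertices below `i`.

private variable
  ℓ ℓ′ : Level
  A B : Set ℓ
  P Q : Set ℓ

-- Finite sums

infixr 5 _▹_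
-- Iverson bracket. Conditions become weights instead of filtered lists, so sums with different
-- conditions run over the same list and can be added, swapped and compared termwise.
_▹_ : Dec P → ℤ → ℤ
P? ▹ c = if does P? then c else 0ℤ

▹-yes : (P? : Dec P) {c : ℤ} → P → P? ▹ c ≡ c
▹-yes P? {c} p = cong (if_then c else 0ℤ) (dec-true P? p)

▹-no : (P? : Dec P) {c : ℤ} → ¬ P → P? ▹ c ≡ 0ℤ
▹-no P? {c} ¬p = cong (if_then c else 0ℤ) (dec-false P? ¬p)

▹-zero : (P? : Dec P) → P? ▹ 0ℤ ≡ 0ℤ
▹-zero (yes _) = refl
▹-zero (no _)  = refl

▹-cong : (P? : Dec P) {c d : ℤ} → (P → c ≡ d) → P? ▹ c ≡ P? ▹ d
▹-cong (yes p) eq = eq p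
▹-cong (no _)  _  = refl

▹-⇔ : P ⇔ Q → (P? : Dec P) (Q? : Dec Q) {c : ℤ} → P? ▹ c ≡ Q? ▹ c
▹-⇔ P⇔Q P? Q? {c} = cong (if_then c else 0ℤ) (does-⇔ P⇔Q P? Q?)

▹-+ : (P? : Dec P) (c d : ℤ) → P? ▹ (c + d) ≡ (P? ▹ c) + (P? ▹ d)
▹-+ (yes _) c d = refl
▹-+ (no _)  c d = refl

▹-*ˡ : (P? : Dec P) (c d : ℤ) → P? ▹ (c * d) ≡ c * (P? ▹ d)
▹-*ˡ (yes _) c d = refl
▹-*ˡ (no _)  c d = sym (ℤ.*-zeroʳ c)

▹-*ʳ : (P? : Dec P) (c d : ℤ) → P? ▹ (c * d) ≡ (P? ▹ c) * d
▹-*ʳ (yes _) c d = refl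
▹-*ʳ (no _)  c d = sym (ℤ.*-zeroˡ d)

▹-comm : (P? : Dec P) (Q? : Dec Q) {c : ℤ} → P? ▹ Q? ▹ c ≡ Q? ▹ P? ▹ c
▹-comm (yes _) (yes _) = refl
▹-comm (yes _) (no _)  = refl
▹-comm (no _)  (yes _) = refl
▹-comm (no _)  (no _)  = refl

▹-× : (P? : Dec P) (Q? : Dec Q) {c : ℤ} → (P? ×-dec Q?) ▹ c ≡ P? ▹ Q? ▹ c
▹-× (yes _) (yes _) = refl
▹-× (yes _) (no _)  = refl
▹-× (no _)  _       = refl

∑ : List A → (A → ℤ) → ℤ
∑ xs f = foldr _+_ 0ℤ (map f xs)

∑-cong-∈ : (xs : List A) {f g : A → ℤ} → (∀ {x} → x ∈ xs → f x ≡ g x) → ∑ xs f ≡ ∑ xs g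
∑-cong-∈ []       eq = refl
∑-cong-∈ (x ∷ xs) eq = cong₂ _+_ (eq (here refl)) (∑-cong-∈ xs (eq ∘ there))

∑-cong : (xs : List A) {f g : A → ℤ} → (∀ x → f x ≡ g x) → ∑ xs f ≡ ∑ xs g
∑-cong xs eq = ∑-cong-∈ xs λ {x} _ → eq x

∑-zero : (xs : List A) {f : A → ℤ} → (∀ {x} → x ∈ xs → f x ≡ 0ℤ) → ∑ xs f ≡ 0ℤ
∑-zero []       eq = refl
∑-zero (x ∷ xs) eq = cong₂ _+_ (eq (here refl)) (∑-zero xs (eq ∘ there))

∑-+ : (xs : List A) (f g : A → ℤ) → ∑ xs (λ x → f x + g x) ≡ ∑ xs f + ∑ xs g
∑-+ []       f g = refl
∑-+ (x ∷ xs) f g = begin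
  f x + g x + ∑ xs (λ y → f y + g y)  ≡⟨ cong (ℤ._+_ (f x + g x)) (∑-+ xs f g) ⟩
  f x + g x + (∑ xs f + ∑ xs g)       ≡⟨ ℤ.+-assoc (f x) (g x) _ ⟩
  f x + (g x + (∑ xs f + ∑ xs g))     ≡⟨ cong (ℤ._+_ (f x)) (ℤ.+-assoc (g x) (∑ xs f) _) ⟨
  f x + (g x + ∑ xs f + ∑ xs g)       ≡⟨ cong (λ z → f x + (z + ∑ xs g)) (ℤ.+-comm (g x) _) ⟩
  f x + (∑ xs f + g x + ∑ xs g)       ≡⟨ cong (ℤ._+_ (f x)) (ℤ.+-assoc (∑ xs f) (g x) _) ⟩
  f x + (∑ xs f + (g x + ∑ xs g))     ≡⟨ ℤ.+-assoc (f x) (∑ xs f) _ ⟨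
  f x + ∑ xs f + (g x + ∑ xs g)       ∎

∑-*ˡ : (xs : List A) (c : ℤ) (f : A → ℤ) → ∑ xs (λ x → c * f x) ≡ c * ∑ xs f
∑-*ˡ []       c f = sym (ℤ.*-zeroʳ c)
∑-*ˡ (x ∷ xs) c f =
  trans (cong (ℤ._+_ (c * f x)) (∑-*ˡ xs c f)) (sym (ℤ.*-distribˡ-+ c (f x) (∑ xs f)))

∑-*ʳ : (xs : List A) (c : ℤ) (f : A → ℤ) → ∑ xs (λ x → f x * c) ≡ ∑ xs f * c
∑-*ʳ xs c f = begin
  ∑ xs (λ x → f x * c)  ≡⟨ ∑-cong xs (λ x → ℤ.*-comm (f x) c) ⟩
  ∑ xs (λ x → c * f x)  ≡⟨ ∑-*ˡ xs c f ⟩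
  c * ∑ xs f            ≡⟨ ℤ.*-comm c _ ⟩
  ∑ xs f * c            ∎

∑-▹ : (P? : Dec P) (xs : List A) (f : A → ℤ) → ∑ xs (λ x → P? ▹ f x) ≡ P? ▹ ∑ xs f
∑-▹ (yes _) xs f = refl
∑-▹ (no _)  xs f = ∑-zero xs λ _ → refl

∑-++ : (xs ys : List A) (f : A → ℤ) → ∑ (xs ++ ys) f ≡ ∑ xs f + ∑ ys f
∑-++ []       ys f = sym (ℤ.+-identityˡ _)
∑-++ (x ∷ xs) ys f = trans (cong (ℤ._+_ (f x)) (∑-++ xs ys f)) (sym (ℤ.+-assoc (f x) _ _))

∑-map : (g : A → B) (xs : List A) (f : B → ℤ) → ∑ (map g xs) f ≡ ∑ xs (f ∘ g)
∑-map g xs f = cong (foldr _+_ 0ℤ) (sym (List.map-∘ xs))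

∑-concatMap : (g : A → List B) (xs : List A) (f : B → ℤ) →
              ∑ (concatMap g xs) f ≡ ∑ xs (λ x → ∑ (g x) f)
∑-concatMap g []       f = refl
∑-concatMap g (x ∷ xs) f =
  trans (∑-++ (g x) (concatMap g xs) f) (cong (ℤ._+_ (∑ (g x) f)) (∑-concatMap g xs f))

∑-filter : {R : Pred A ℓ} (R? : Decidable R) (xs : List A) (f : A → ℤ) →
           ∑ (filter R? xs) f ≡ ∑ xs (λ x → R? x ▹ f x)
∑-filter R? []       f = refl
∑-filter R? (x ∷ xs) f with does (R? x)
... | true  = cong (ℤ._+_ (f x)) (∑-filter R? xs f)
... | false = trans (∑-filter R? xs f) (sym (ℤ.+-identityˡ _))

∑-swap : (xs : List A) (ys : List B) (f : A → B → ℤ) →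
         ∑ xs (λ x → ∑ ys (f x)) ≡ ∑ ys (λ y → ∑ xs (λ x → f x y))
∑-swap []       ys f = sym (∑-zero ys λ _ → refl)
∑-swap (x ∷ xs) ys f =
  trans (cong (ℤ._+_ (∑ ys (f x))) (∑-swap xs ys f)) (sym (∑-+ ys (f x) _))

∑-length : (xs : List A) → ∑ xs (λ _ → 1ℤ) ≡ + length xs
∑-length []       = refl
∑-length (x ∷ xs) = cong (ℤ._+_ 1ℤ) (∑-length xs)

-- The condition is any predicate with a single solution, so that conjunctions such as `F ⊆ H` with
-- `|F| = |H|` are covered as well as equations.
∑-δ : {R : Pred A ℓ} (R? : Decidable R) {x₀ : A} (xs : List A) (f : A → ℤ) →
      Unique xs → x₀ ∈ xs → R x₀ → (∀ {x} → R x → x ≡ x₀) → ∑ xs (λ x → R? x ▹ f x) ≡ f x₀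
∑-δ R? {x₀} (.x₀ ∷ xs) f (x₀# ∷ _) (here refl) Rx₀ only = begin
  (R? x₀ ▹ f x₀) + ∑ xs (λ x → R? x ▹ f x)  ≡⟨ cong₂ _+_ (▹-yes (R? x₀) Rx₀)
    (∑-zero xs λ {x} x∈ → ▹-no (R? x) λ Rx → All.lookup x₀# x∈ (sym (only Rx))) ⟩
  f x₀ + 0ℤ                                 ≡⟨ ℤ.+-identityʳ _ ⟩
  f x₀                                      ∎
∑-δ R? {x₀} (x ∷ xs) f (x# ∷ u) (there x₀∈) Rx₀ only = begin
  (R? x ▹ f x) + ∑ xs (λ x → R? x ▹ f x)  ≡⟨ cong₂ _+_
    (▹-no (R? x) λ Rx → All.lookup x# x₀∈ (only Rx)) (∑-δ R? xs f u x₀∈ Rx₀ only) ⟩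
  0ℤ + f x₀                               ≡⟨ ℤ.+-identityˡ _ ⟩
  f x₀                                    ∎

module _ (f : ℕ → ℤ) where

  private
    ∑-upTo-extend : ∀ {m n} → m ℕ.≤′ n → (∀ k → m ≤ k → f k ≡ 0ℤ) → ∑ (upTo m) f ≡ ∑ (upTo n) f
    ∑-upTo-extend ℕ.≤′-refl _ = refl
    ∑-upTo-extend {m} {suc n} (ℕ.≤′-step m≤n) f≡0 = begin
      ∑ (upTo m) f               ≡⟨ ∑-upTo-extend m≤n f≡0 ⟩
      ∑ (upTo n) f               ≡⟨ ℤ.+-identityʳ _ ⟨
      ∑ (upTo n) f + 0ℤ          ≡⟨ cong (λ z → ∑ (upTo n) f + (z + 0ℤ)) (f≡0 n (ℕ.≤′⇒≤ m≤n)) ⟨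
      ∑ (upTo n) f + (f n + 0ℤ)  ≡⟨ ∑-++ (upTo n) (n ∷ []) f ⟨
      ∑ (upTo n ++ n ∷ []) f     ≡⟨ cong (λ ks → ∑ ks f) (List.upTo-∷ʳ n) ⟩
      ∑ (upTo (suc n)) f         ∎

  -- Neither bound need be the larger one: a poset may have more elements than its rank, or fewer
  -- when ranks jump.
  ∑-upTo-truncate : ∀ m n → (∀ k → m ≤ k → f k ≡ 0ℤ) → (∀ k → n ≤ k → f k ≡ 0ℤ) →
                    ∑ (upTo m) f ≡ ∑ (upTo n) f
  ∑-upTo-truncate m n m-zero n-zero with ℕ.≤-total m n
  ... | inj₁ m≤n = ∑-upTo-extend (ℕ.≤⇒≤′ m≤n) m-zero
  ... | inj₂ n≤m = sym (∑-upTo-extend (ℕ.≤⇒≤′ n≤m) n-zero)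

-- Coefficients of noncommutative polynomials

-- Coefficient functions replace formal sums: `_≈_` is their pointwise equality, so every identity
-- becomes one between integers.
Series : Set
Series = Word → ℤ

-- shift u f is the coefficient function of u · p when f is the one of p.
shift : Word → Series → Series
shift []      f w       = f w
shift (x ∷ u) f []      = 0ℤ
shift (x ∷ u) f (y ∷ w) = (x ≟ᴸ y) ▹ shift u f w

-- Chains are extended on the left, so only the right factor varies. Keeping the left factor as a
-- list of terms makes the product visibly additive in the right one.
_⊛_ : Poly → Series → Series
(p ⊛ f) w = ∑ p λ (c , u) → c * shift u f w

shift-cong : ∀ u {f g : Series} → (∀ w → f w ≡ g w) → ∀ w → shift u f w ≡ shift u g w
shift-cong []      eq w       = eq w
shift-cong (x ∷ u) eq []      = refl
shift-cong (x ∷ u) eq (y ∷ w) = ▹-cong (x ≟ᴸ y) λ _ → shift-cong u eq w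

shift-∑ : ∀ u (xs : List A) (f : A → Series) w →
          shift u (λ w → ∑ xs (λ x → f x w)) w ≡ ∑ xs (λ x → shift u (f x) w)
shift-∑ []      xs f w       = refl
shift-∑ (x ∷ u) xs f []      = sym (∑-zero xs λ _ → refl)
shift-∑ (x ∷ u) xs f (y ∷ w) =
  trans (cong (x ≟ᴸ y ▹_) (shift-∑ u xs f w)) (sym (∑-▹ (x ≟ᴸ y) xs _))

shift-▹ : ∀ u (P? : Dec P) (f : Series) w → shift u (λ w → P? ▹ f w) w ≡ P? ▹ shift u f w
shift-▹ []      P? f w       = refl
shift-▹ (x ∷ u) P? f []      = sym (▹-zero P?)
shift-▹ (x ∷ u) P? f (y ∷ w) =
  trans (cong (x ≟ᴸ y ▹_) (shift-▹ u P? f w)) (▹-comm (x ≟ᴸ y) P?)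

⊛-cong : ∀ p {f g : Series} → (∀ w → f w ≡ g w) → ∀ w → (p ⊛ f) w ≡ (p ⊛ g) w
⊛-cong p eq w = ∑-cong p λ (c , u) → cong (c *_) (shift-cong u eq w)

⊛-∑ : ∀ p (xs : List A) (f : A → Series) w →
      (p ⊛ (λ w → ∑ xs (λ x → f x w))) w ≡ ∑ xs (λ x → (p ⊛ f x) w)
⊛-∑ p xs f w = begin
  ∑ p (λ (c , u) → c * shift u (λ w → ∑ xs (λ x → f x w)) w)
    ≡⟨ ∑-cong p (λ (c , u) → trans (cong (c *_) (shift-∑ u xs f w)) (sym (∑-*ˡ xs c _))) ⟩
  ∑ p (λ (c , u) → ∑ xs (λ x → c * shift u (f x) w))
    ≡⟨ ∑-swap p xs _ ⟩
  ∑ xs (λ x → (p ⊛ f x) w) ∎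

⊛-▹ : ∀ p (P? : Dec P) (f : Series) w → (p ⊛ (λ w → P? ▹ f w)) w ≡ P? ▹ (p ⊛ f) w
⊛-▹ p P? f w = begin
  ∑ p (λ (c , u) → c * shift u (λ w → P? ▹ f w) w)
    ≡⟨ ∑-cong p (λ (c , u) → trans (cong (c *_) (shift-▹ u P? f w)) (sym (▹-*ˡ P? c _))) ⟩
  ∑ p (λ (c , u) → P? ▹ c * shift u f w)
    ≡⟨ ∑-▹ P? p _ ⟩
  P? ▹ (p ⊛ f) w ∎

⊛-zero : ∀ p {f : Series} → (∀ w → f w ≡ 0ℤ) → ∀ w → (p ⊛ f) w ≡ 0ℤ
⊛-zero p f≡0 w = trans (⊛-cong p f≡0 w) (⊛-∑ {A = ℕ} p [] (λ _ _ → 0ℤ) w)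

coeff-∑ : ∀ p w → coeff p w ≡ ∑ p (λ (c , u) → List.≡-dec _≟ᴸ_ u w ▹ c)
coeff-∑ []      w = refl
coeff-∑ ((c , u) ∷ p) w = cong (ℤ._+_ (List.≡-dec _≟ᴸ_ u w ▹ c)) (coeff-∑ p w)

coeff-++ : ∀ p q w → coeff (p +ᵖ q) w ≡ coeff p w + coeff q w
coeff-++ []            q w = sym (ℤ.+-identityˡ _)
coeff-++ ((c , u) ∷ p) q w =
  trans (cong (ℤ._+_ (List.≡-dec _≟ᴸ_ u w ▹ c)) (coeff-++ p q w))
        (sym (ℤ.+-assoc (List.≡-dec _≟ᴸ_ u w ▹ c) _ _))

coeff-· : ∀ c p w → coeff (c · p) w ≡ c * coeff p w
coeff-· c []            w = sym (ℤ.*-zeroʳ c)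
coeff-· c ((d , u) ∷ p) w = begin
  (u≟w ▹ c * d) + coeff (c · p) w    ≡⟨ cong₂ _+_ (▹-*ˡ u≟w c d) (coeff-· c p w) ⟩
  c * (u≟w ▹ d) + c * coeff p w      ≡⟨ ℤ.*-distribˡ-+ c (u≟w ▹ d) _ ⟨
  c * ((u≟w ▹ d) + coeff p w)        ∎
  where u≟w = List.≡-dec _≟ᴸ_ u w

coeff-sumᵖ : ∀ ps w → coeff (sumᵖ ps) w ≡ ∑ ps (λ p → coeff p w)
coeff-sumᵖ []       w = refl
coeff-sumᵖ (p ∷ ps) w = trans (coeff-++ p (sumᵖ ps) w) (cong (ℤ._+_ (coeff p w)) (coeff-sumᵖ ps w))

shift-word : ∀ u v c w → shift u (λ w → List.≡-dec _≟ᴸ_ v w ▹ c) w ≡ List.≡-dec _≟ᴸ_ (u ++ v) w ▹ c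
shift-word []      v c w       = refl
shift-word (x ∷ u) v c []      = refl
shift-word (x ∷ u) v c (y ∷ w) with x ≟ᴸ y
... | yes _ = shift-word u v c w
... | no  _ = refl

coeff-term : ∀ c u q w → coeff (map (λ (d , v) → c * d , u ++ v) q) w ≡ c * shift u (coeff q) w
coeff-term c u q w = begin
  coeff (map (λ (d , v) → c * d , u ++ v) q) w
    ≡⟨ coeff-∑ (map _ q) w ⟩
  ∑ (map (λ (d , v) → c * d , u ++ v) q) (λ (d , v) → List.≡-dec _≟ᴸ_ v w ▹ d)
    ≡⟨ ∑-map _ q _ ⟩
  ∑ q (λ (d , v) → List.≡-dec _≟ᴸ_ (u ++ v) w ▹ c * d)
    ≡⟨ ∑-cong q (λ (d , v) → trans (▹-*ˡ (List.≡-dec _≟ᴸ_ (u ++ v) w) c d)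
                                   (cong (c *_) (sym (shift-word u v d w)))) ⟩
  ∑ q (λ (d , v) → c * shift u (λ w → List.≡-dec _≟ᴸ_ v w ▹ d) w)
    ≡⟨ ∑-*ˡ q c _ ⟩
  c * ∑ q (λ (d , v) → shift u (λ w → List.≡-dec _≟ᴸ_ v w ▹ d) w)
    ≡⟨ cong (c *_) (shift-∑ u q _ w) ⟨
  c * shift u (λ w → ∑ q (λ (d , v) → List.≡-dec _≟ᴸ_ v w ▹ d)) w
    ≡⟨ cong (c *_) (shift-cong u (coeff-∑ q) w) ⟨
  c * shift u (coeff q) w ∎

coeff-*ᵖ : ∀ p q w → coeff (p *ᵖ q) w ≡ (p ⊛ coeff q) w
coeff-*ᵖ []            q w = refl
coeff-*ᵖ ((c , u) ∷ p) q w =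
  trans (coeff-++ (map _ q) (p *ᵖ q) w) (cong₂ _+_ (coeff-term c u q w) (coeff-*ᵖ p q w))

⊛-*ˡ : ∀ p c (f : Series) w → (p ⊛ (λ w → c * f w)) w ≡ c * (p ⊛ f) w
⊛-*ˡ p c f w = trans (∑-cong p λ (d , u) → shiftd d u) (∑-*ˡ p c _)
  where
  shift-*ˡ : ∀ u w → shift u (λ w → c * f w) w ≡ c * shift u f w
  shift-*ˡ []      w       = refl
  shift-*ˡ (x ∷ u) []      = sym (ℤ.*-zeroʳ c)
  shift-*ˡ (x ∷ u) (y ∷ w) = trans (cong (x ≟ᴸ y ▹_) (shift-*ˡ u w)) (▹-*ˡ (x ≟ᴸ y) c _)
  shiftd : ∀ d u → d * shift u (λ w → c * f w) w ≡ c * (d * shift u f w)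
  shiftd d u = begin
    d * shift u (λ w → c * f w) w ≡⟨ cong (d *_) (shift-*ˡ u w) ⟩
    d * (c * shift u f w)         ≡⟨ ℤ.*-assoc d c _ ⟨
    d * c * shift u f w           ≡⟨ cong (_* shift u f w) (ℤ.*-comm d c) ⟩
    c * d * shift u f w           ≡⟨ ℤ.*-assoc c d _ ⟩
    c * (d * shift u f w)         ∎

-- Sums over chains

module _ {R : Pred A ℓ} {S : Pred A ℓ′} (R? : Decidable R) (S? : Decidable S)
         (R⊆S : ∀ {x} → R x → S x) where

  length-filter-≤ : ∀ xs → length (filter R? xs) ≤ length (filter S? xs)
  length-filter-≤ []       = z≤n
  length-filter-≤ (x ∷ xs) with R? x | S? x
  ... | yes _  | yes _  = s≤s (length-filter-≤ xs)
  ... | yes Rx | no ¬Sx = contradiction (R⊆S Rx) ¬Sx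
  ... | no _   | yes _  = ℕ.m≤n⇒m≤1+n (length-filter-≤ xs)
  ... | no _   | no _   = length-filter-≤ xs

  length-filter-< : ∀ xs → Any (λ x → S x × ¬ R x) xs →
                    length (filter R? xs) < length (filter S? xs)
  length-filter-< (x ∷ xs) (here (Sx , ¬Rx))
    rewrite dec-true (S? x) Sx | dec-false (R? x) ¬Rx = s≤s (length-filter-≤ xs)
  length-filter-< (x ∷ xs) (there some) with R? x | S? x
  ... | yes _  | yes _  = s≤s (length-filter-< xs some)
  ... | yes Rx | no ¬Sx = contradiction (R⊆S Rx) ¬Sx
  ... | no _   | yes _  = ℕ.m≤n⇒m≤1+n (length-filter-< xs some)
  ... | no _   | no _   = length-filter-< xs some

-- The factor of a step from rank `s` to an interior point of rank `t`. The final step of a chain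
-- carries no `b` and is treated apart.
edgePoly : ℕ → ℕ → Poly
edgePoly s t = (a -ᵖ b) ^ᵖ (t ∸ s ∸ 1) *ᵖ b

edge : ℕ → ℕ → Series → Series
edge s t = edgePoly s t ⊛_

module _ (𝐏 : QuasiGradedPoset) (𝐏-bounded : Bounded 𝐏) where
  open QuasiGradedPoset 𝐏
  open Bounded 𝐏-bounded

  chainTerm : Carrier → List Carrier → Poly
  chainTerm x xs = ζ̄-product 𝐏 𝐏-bounded x xs · ab-product 𝐏 𝐏-bounded x xs

  chainSum : ℕ → Carrier → Series
  chainSum k x w = ∑ (chains 𝐏 𝐏-bounded k x) λ xs → coeff (chainTerm x xs) w

  coeff-chainTerm-∷ : ∀ x y ys w →
    coeff (chainTerm x (y ∷ ys)) w ≡ ζ̄ x y * edge (ρ x) (ρ y) (coeff (chainTerm y ys)) w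
  coeff-chainTerm-∷ x y ys w = begin
    coeff (chainTerm x (y ∷ ys)) w
      ≡⟨ coeff-· (ζ̄ x y * z) (e *ᵖ ab) w ⟩
    ζ̄ x y * z * coeff (e *ᵖ ab) w
      ≡⟨ cong (ζ̄ x y * z *_) (coeff-*ᵖ e ab w) ⟩
    ζ̄ x y * z * edge (ρ x) (ρ y) (coeff ab) w
      ≡⟨ ℤ.*-assoc (ζ̄ x y) z _ ⟩
    ζ̄ x y * (z * edge (ρ x) (ρ y) (coeff ab) w)
      ≡⟨ cong (ζ̄ x y *_) (⊛-*ˡ e z (coeff ab) w) ⟨
    ζ̄ x y * edge (ρ x) (ρ y) (λ w → z * coeff ab w) w
      ≡⟨ cong (ζ̄ x y *_) (⊛-cong e (coeff-· z ab) w) ⟨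
    ζ̄ x y * edge (ρ x) (ρ y) (coeff (chainTerm y ys)) w ∎
    where
    e  = edgePoly (ρ x) (ρ y)
    z  = ζ̄-product 𝐏 𝐏-bounded y ys
    ab = ab-product 𝐏 𝐏-bounded y ys

  chainSum-suc : ∀ k x w → chainSum (suc k) x w ≡
    ∑ elements (λ y → (x ≺? y) ▹ ζ̄ x y * edge (ρ x) (ρ y) (chainSum k y) w)
  chainSum-suc k x w = begin
    chainSum (suc k) x w
      ≡⟨ ∑-concatMap _ (filter (x ≺?_) elements) _ ⟩
    ∑ (filter (x ≺?_) elements) (λ y →
      ∑ (map (y ∷_) (chains 𝐏 𝐏-bounded k y)) λ xs → coeff (chainTerm x xs) w)
      ≡⟨ ∑-filter (x ≺?_) elements _ ⟩
    ∑ elements (λ y → (x ≺? y) ▹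
      ∑ (map (y ∷_) (chains 𝐏 𝐏-bounded k y)) λ xs → coeff (chainTerm x xs) w)
      ≡⟨ ∑-cong elements (λ y → cong ((x ≺? y) ▹_) (through y)) ⟩
    ∑ elements (λ y → (x ≺? y) ▹ ζ̄ x y * edge (ρ x) (ρ y) (chainSum k y) w) ∎
    where
    through : ∀ y → ∑ (map (y ∷_) (chains 𝐏 𝐏-bounded k y)) (λ xs → coeff (chainTerm x xs) w) ≡
                    ζ̄ x y * edge (ρ x) (ρ y) (chainSum k y) w
    through y = begin
      ∑ (map (y ∷_) ys) (λ xs → coeff (chainTerm x xs) w)
        ≡⟨ ∑-map (y ∷_) ys _ ⟩
      ∑ ys (λ xs → coeff (chainTerm x (y ∷ xs)) w)
        ≡⟨ ∑-cong ys (λ xs → coeff-chainTerm-∷ x y xs w) ⟩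
      ∑ ys (λ xs → ζ̄ x y * edge (ρ x) (ρ y) (coeff (chainTerm y xs)) w)
        ≡⟨ ∑-*ˡ ys (ζ̄ x y) _ ⟩
      ζ̄ x y * ∑ ys (λ xs → edge (ρ x) (ρ y) (coeff (chainTerm y xs)) w)
        ≡⟨ cong (ζ̄ x y *_) (⊛-∑ (edgePoly (ρ x) (ρ y)) ys _ w) ⟨
      ζ̄ x y * edge (ρ x) (ρ y) (chainSum k y) w ∎
      where ys = chains 𝐏 𝐏-bounded k y

  -- A chain from `x` to `1̂` with `k` interior points has `k + 1` steps, each lowering `μ`, which
  -- is impossible when `μ x ≤ k`. The measure is a parameter because two are used: the number of
  -- elements above `x`, and the corank of `x`.
  chainSum-vanish : (μ : Carrier → ℕ) → (∀ {x y} → x ≺ y → μ y < μ x) →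
                    ∀ k x → μ x ≤ k → ∀ w → chainSum k x w ≡ 0ℤ
  chainSum-vanish μ μ-anti zero x μx≤0 w
    rewrite dec-false (x ≺? 1̂) (λ x≺1̂ → ℕ.n≮0 (ℕ.<-≤-trans (μ-anti x≺1̂) μx≤0)) = refl
  chainSum-vanish μ μ-anti (suc k) x μx≤k w =
    trans (chainSum-suc k x w) (∑-zero elements λ {y} _ → trans
      (▹-cong (x ≺? y) λ x≺y → trans
        (cong (ζ̄ x y *_) (⊛-zero (edgePoly (ρ x) (ρ y)) (chainSum-vanish μ μ-anti k y
          (ℕ.s≤s⁻¹ (ℕ.≤-trans (μ-anti x≺y) μx≤k))) w))
        (ℤ.*-zeroʳ (ζ̄ x y)))
      (▹-zero (x ≺? y)))

  private
    above : Carrier → ℕ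
    above x = length (filter (x ≺?_) elements)

    ≺-trans : ∀ {x y z} → x ≺ y → y ≺ z → x ≺ z
    ≺-trans x≺y@(x≼y , x≢y) y≺z@(y≼z , _) = PO.trans x≼y y≼z , λ where
        refl → ℕ.<-asym (ρ-mono x≺y) (ρ-mono y≺z)
      where module PO = IsDecPartialOrder isDecPartialOrder

    above-anti : ∀ {x y} → x ≺ y → above y < above x
    above-anti {x} {y} x≺y = length-filter-< (y ≺?_) (x ≺?_) (≺-trans x≺y) elements
      (Any.map (λ where refl → x≺y , λ y≺y → proj₂ y≺y refl) (elements-complete y))

  -- The rank as summation bound is `n + 1` for every semisuspension, whereas `length elements`
  -- depends on the complex.
  coeff-Ψ : ∀ w → coeff (Ψ 𝐏 𝐏-bounded) w ≡ ∑ (upTo (ρ 1̂ ∸ ρ 0̂)) (λ k → chainSum k 0̂ w)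
  coeff-Ψ w = begin
    coeff (Ψ 𝐏 𝐏-bounded) w
      ≡⟨ coeff-sumᵖ (map (chainTerm 0̂) allChains) w ⟩
    ∑ (map (chainTerm 0̂) allChains) (λ p → coeff p w)
      ≡⟨ ∑-map (chainTerm 0̂) allChains _ ⟩
    ∑ allChains (λ xs → coeff (chainTerm 0̂ xs) w)
      ≡⟨ ∑-concatMap _ (upTo (length elements)) _ ⟩
    ∑ (upTo (length elements)) (λ k → chainSum k 0̂ w)
      ≡⟨ ∑-upTo-truncate _ (length elements) (ρ 1̂ ∸ ρ 0̂)
           (λ k len≤k → chainSum-vanish above above-anti k 0̂
              (ℕ.≤-trans (List.length-filter (0̂ ≺?_) elements) len≤k) w)
           (λ k rank≤k → chainSum-vanish (λ x → ρ 1̂ ∸ ρ x) corank-anti k 0̂ rank≤k w) ⟩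
    ∑ (upTo (ρ 1̂ ∸ ρ 0̂)) (λ k → chainSum k 0̂ w) ∎
    where
    allChains = concatMap (λ k → chains 𝐏 𝐏-bounded k 0̂) (upTo (length elements))

    ρ≤ρ1̂ : ∀ x → ρ x ≤ ρ 1̂
    ρ≤ρ1̂ x with x ≟ 1̂
    ... | yes refl = ℕ.≤-refl
    ... | no x≢1̂  = ℕ.<⇒≤ (ρ-mono (maximum x , x≢1̂))

    corank-anti : ∀ {x y} → x ≺ y → ρ 1̂ ∸ ρ y < ρ 1̂ ∸ ρ x
    corank-anti {x} {y} x≺y = ℕ.∸-monoʳ-< (ρ-mono x≺y) (ρ≤ρ1̂ y)

-- Semisuspensions

-- Σ_j C(d,j) φ(m+j), which is the sum of φ|G| over the sets G between a set of
-- size m and a superset of size m + d.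
interval : (ℕ → ℤ) → ℕ → ℕ → ℤ
interval φ zero    m = φ m
interval φ (suc d) m = interval φ d m + interval φ d (suc m)

interval-suc : ∀ φ d m → interval (φ ∘ suc) d m ≡ interval φ d (suc m)
interval-suc φ zero    m = refl
interval-suc φ (suc d) m = cong₂ _+_ (interval-suc φ d m) (interval-suc φ d (suc m))

∑-subsets-suc : ∀ {v} (f : Subset (suc v) → ℤ) →
  ∑ (subsets (suc v)) f ≡ ∑ (subsets v) (f ∘ (outside ∷_)) + ∑ (subsets v) (f ∘ (inside ∷_))
∑-subsets-suc {v} f = trans (∑-++ (map (outside ∷_) (subsets v)) _ f)
  (cong₂ _+_ (∑-map (outside ∷_) (subsets v) f) (∑-map (inside ∷_) (subsets v) f))

between : ∀ {v} → (ℕ → ℤ) → Subset v → Subset v → Subset v → ℤ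
between φ R F G = (R Sub.⊆? G) ▹ (G Sub.⊆? F) ▹ φ ∣ G ∣

-- Induction over the vertices: a vertex of `F` outside `R` may be left out or put in, which gives
-- the two summands of `interval`; every other vertex leaves no choice.
∑-between : ∀ {v} (φ : ℕ → ℤ) (R F : Subset v) → R ⊆ F →
  ∑ (subsets v) (between φ R F) ≡ interval φ (∣ F ∣ ∸ ∣ R ∣) ∣ R ∣
∑-between φ [] [] _ = ℤ.+-identityʳ (φ 0)
∑-between {suc v} φ (outside ∷ R) (outside ∷ F) R⊆F = begin
  _ ≡⟨ ∑-subsets-suc (between φ (outside ∷ R) (outside ∷ F)) ⟩
  _ ≡⟨ cong₂ _+_ (∑-between φ R F (Sub.drop-∷-⊆ R⊆F))
                 (∑-zero (subsets v) λ {G} _ → ▹-zero (R Sub.⊆? G)) ⟩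
  (interval φ (∣ F ∣ ∸ ∣ R ∣) ∣ R ∣) + 0ℤ ≡⟨ ℤ.+-identityʳ _ ⟩
  interval φ (∣ F ∣ ∸ ∣ R ∣) ∣ R ∣ ∎
∑-between {suc v} φ (outside ∷ R) (inside ∷ F) R⊆F = begin
  _ ≡⟨ ∑-subsets-suc (between φ (outside ∷ R) (inside ∷ F)) ⟩
  _ ≡⟨ cong₂ _+_ (∑-between φ R F (Sub.drop-∷-⊆ R⊆F))
                 (trans (∑-between (φ ∘ suc) R F (Sub.drop-∷-⊆ R⊆F))
                        (interval-suc φ (∣ F ∣ ∸ ∣ R ∣) ∣ R ∣)) ⟩
  interval φ (suc (∣ F ∣ ∸ ∣ R ∣)) ∣ R ∣
    ≡⟨ cong (λ d → interval φ d ∣ R ∣)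
         -- The subtraction is truncated, so `|R| ≤ |F|` is needed to move the successor out.
         (ℕ.+-∸-assoc 1 (Sub.p⊆q⇒∣p∣≤∣q∣ (Sub.drop-∷-⊆ R⊆F))) ⟨
  interval φ (suc ∣ F ∣ ∸ ∣ R ∣) ∣ R ∣ ∎
∑-between φ (inside ∷ R) (outside ∷ F) R⊆F with () ← R⊆F Vec.here
∑-between {suc v} φ (inside ∷ R) (inside ∷ F) R⊆F = begin
  _ ≡⟨ ∑-subsets-suc (between φ (inside ∷ R) (inside ∷ F)) ⟩
  _ ≡⟨ cong₂ _+_ (∑-zero (subsets v) λ _ → refl) (∑-between (φ ∘ suc) R F (Sub.drop-∷-⊆ R⊆F)) ⟩
  0ℤ + interval (φ ∘ suc) (∣ F ∣ ∸ ∣ R ∣) ∣ R ∣ ≡⟨ ℤ.+-identityˡ _ ⟩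
  interval (φ ∘ suc) (∣ F ∣ ∸ ∣ R ∣) ∣ R ∣ ≡⟨ interval-suc φ (∣ F ∣ ∸ ∣ R ∣) ∣ R ∣ ⟩
  interval φ (∣ F ∣ ∸ ∣ R ∣) (suc ∣ R ∣) ∎

∑-between-▹ : ∀ {v} (φ : ℕ → ℤ) (R F : Subset v) →
  ∑ (subsets v) (between φ R F) ≡
  (R Sub.⊆? F) ▹ interval φ (∣ F ∣ ∸ ∣ R ∣) ∣ R ∣
∑-between-▹ φ R F with R Sub.⊆? F
... | yes R⊆F = ∑-between φ R F R⊆F
... | no R⊈F  = ∑-zero (subsets _) λ {G} _ → trans
  (▹-cong (R Sub.⊆? G) λ R⊆G → ▹-no (G Sub.⊆? F) λ G⊆F → R⊈F (Sub.⊆-trans {k = F} R⊆G G⊆F))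
  (▹-zero (R Sub.⊆? G))

module _ (n : ℕ) where

  -- The factor `1ℤ` is `ζ̄` on the step to `1̂`; it is kept so that the term of a chain without
  -- interior points has this form by computation.
  lastStep : ℕ → Series
  lastStep s = coeff (1ℤ · (a -ᵖ b) ^ᵖ (suc n ∸ s ∸ 1))

  -- Only `1̂` lies above `*`, so a chain starting at `*` has no interior point.
  starSum : ℕ → Series
  starSum zero    = lastStep n
  starSum (suc k) w = 0ℤ

  -- faceWeight k s t is the contribution of a face H of size t to the sum over
  -- the chains with k interior points starting at a face F ⊆ H of size s; the
  -- first summand distributes ζ̄(F,*) over the faces H of its reduced Euler
  -- characteristic, the constant 1 being attached to H = F.
  faceWeight : ℕ → ℕ → ℕ → Series
  faceWeight zero    s t w = (s ℕ.≟ t) ▹ lastStep s w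
  faceWeight (suc k) s t w =
    ((s ℕ.<? n) ▹ (((s ℕ.≟ t) ▹ 1ℤ) + -1ℤ ℤ.^ (n ∸ s) * -1ℤ ℤ.^ suc (t ∸ s))
                  * edge s n (starSum k) w)
    + interval (λ m → (s ℕ.<? m) ▹ edge s m (faceWeight k m t) w) (t ∸ s) s

  -- The start size `0` is that of the minimal element, the empty face; no chain from it has more
  -- than `n` interior points.
  faceSeries : ℕ → Series
  faceSeries t w = ∑ (upTo (suc n)) (λ k → faceWeight k 0 t w)

module _ {v : ℕ} (Δ : SimplicialComplex v) where
  open SimplicialComplex Δ

  ∑-allFaces : (f : Subset v → ℤ) → ∑ (allFaces Δ) (f ∘ value) ≡ ∑ faces f
  ∑-allFaces f = trans (sym (∑-map value (allFaces Δ) f))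
    (cong (λ Fs → ∑ Fs f) (map-value-restrict Δ (subsets v)))

  value-∈-faces : (F : FaceOf Δ) → value F ∈ faces
  value-∈-faces F = subst (value F ∈_) (map-value-restrict Δ (subsets v))
    (∈-map⁺ value (allFaces-complete Δ F))

  -- The only face of the size of `F` above `F` is `F` itself. Expressing `H = F` through sizes lets
  -- a constant be absorbed into a weight that sees only `|F|` and `|H|`.
  ∑-same-size : (F : FaceOf Δ) (c : ℤ) →
    ∑ faces (λ H → (value F Sub.⊆? H) ▹ (∣ value F ∣ ℕ.≟ ∣ H ∣) ▹ c) ≡ c
  ∑-same-size F c = trans
    (∑-cong faces λ H → sym (▹-× (value F Sub.⊆? H) (∣ value F ∣ ℕ.≟ ∣ H ∣)))
    (∑-δ (λ H → (value F Sub.⊆? H) ×-dec (∣ value F ∣ ℕ.≟ ∣ H ∣)) faces (λ _ → c)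
      (Unique.filter⁺ Face? (subsets-unique v)) (value-∈-faces F)
      (Sub.⊆-refl , refl) λ (F⊆H , eq) → sym (⊆∧size⇒≡ F⊆H eq))

  module _ (n : ℕ) (1≤n : 1 ≤ n) (dim<n : dim Δ ℤ.< + n) where
    open Semisuspension Δ n renaming (* to ⋆)

    private
      module 𝐏 = QuasiGradedPoset (poset dim<n)

      T : ℕ → Element → Series
      T = chainSum (poset dim<n) (bounded dim<n 1≤n)

      T-suc : ∀ k x w → T (suc k) x w ≡
        ∑ elementsˢ (λ y → (x 𝐏.≺? y) ▹ ζ̄ˢ x y * edge (ρˢ x) (ρˢ y) (T k y) w)
      T-suc = chainSum-suc (poset dim<n) (bounded dim<n 1≤n)

      T-1̂ : ∀ k w → T k 1̂ w ≡ 0ℤ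
      T-1̂ zero    w = refl
      T-1̂ (suc k) w = trans (T-suc k 1̂ w)
        (∑-zero elementsˢ λ {y} _ → ▹-no (1̂ 𝐏.≺? y) λ where (≤1̂ , 1̂≢1̂) → 1̂≢1̂ refl)

      -- The element list offers `1̂` as an interior point too; such a chain cannot be continued to
      -- `1̂` by a strict step, so its term vanishes.
      step-to-1̂ : ∀ k x w → (x 𝐏.≺? 1̂) ▹ ζ̄ˢ x 1̂ * edge (ρˢ x) (suc n) (T k 1̂) w ≡ 0ℤ
      step-to-1̂ k x w = begin
        (x 𝐏.≺? 1̂) ▹ ζ̄ˢ x 1̂ * edge (ρˢ x) (suc n) (T k 1̂) w
          ≡⟨ cong (λ z → (x 𝐏.≺? 1̂) ▹ ζ̄ˢ x 1̂ * z) (⊛-zero (edgePoly (ρˢ x) (suc n)) (T-1̂ k) w) ⟩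
        (x 𝐏.≺? 1̂) ▹ ζ̄ˢ x 1̂ * 0ℤ
          ≡⟨ cong ((x 𝐏.≺? 1̂) ▹_) (ℤ.*-zeroʳ (ζ̄ˢ x 1̂)) ⟩
        (x 𝐏.≺? 1̂) ▹ 0ℤ
          ≡⟨ ▹-zero (x 𝐏.≺? 1̂) ⟩
        0ℤ ∎

      T-⋆ : ∀ k w → T k ⋆ w ≡ starSum n k w
      T-⋆ zero    w = ℤ.+-identityʳ _
      T-⋆ (suc k) w = trans (T-suc k ⋆ w) (∑-zero elementsˢ λ {y} _ → step y)
        where
        step : ∀ y → (⋆ 𝐏.≺? y) ▹ ζ̄ˢ ⋆ y * edge n (ρˢ y) (T k y) w ≡ 0ℤ
        step (face F) = refl
        step ⋆        = refl
        step 1̂        = step-to-1̂ k ⋆ w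

      T-face : ∀ k F w → T k (face F) w ≡
        ∑ faces (λ H → (value F Sub.⊆? H) ▹ faceWeight n k ∣ value F ∣ ∣ H ∣ w)
      T-face zero    F w = trans (ℤ.+-identityʳ _) (sym (∑-same-size F (lastStep n ∣ value F ∣ w)))
      T-face (suc k) F w = begin
        T (suc k) (face F) w
          ≡⟨ T-suc k (face F) w ⟩
        ∑ elementsˢ step
          ≡⟨ cong₂ _+_ star (cong₂ _+_ (step-to-1̂ k (face F) w) (∑-map face (allFaces Δ) step)) ⟩
        ∑ faces starPart + (0ℤ + ∑ (allFaces Δ) (step ∘ face))
          ≡⟨ cong (ℤ._+_ (∑ faces starPart)) (trans (ℤ.+-identityˡ _) through-faces) ⟩
        ∑ faces starPart + ∑ faces facePart
          ≡⟨ ∑-+ faces starPart facePart ⟨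
        ∑ faces (λ H → starPart H + facePart H)
          ≡⟨ ∑-cong faces (λ H → ▹-+ (value F Sub.⊆? H) _ _) ⟨
        ∑ faces (λ H → (value F Sub.⊆? H) ▹ faceWeight n (suc k) s ∣ H ∣ w) ∎
        where
        s = ∣ value F ∣
        E = edge s n (starSum n k) w
        c = -1ℤ ℤ.^ (n ∸ s)

        step : Element → ℤ
        step y = (face F 𝐏.≺? y) ▹ ζ̄ˢ (face F) y * edge s (ρˢ y) (T k y) w

        share : Subset v → ℤ
        share H = ((s ℕ.≟ ∣ H ∣) ▹ 1ℤ) + c * -1ℤ ℤ.^ suc (∣ H ∣ ∸ s)

        starPart : Subset v → ℤ
        starPart H = (value F Sub.⊆? H) ▹ (s ℕ.<? n) ▹ share H * E

        weight : ℕ → ℕ → Series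
        weight t m w = (s ℕ.<? m) ▹ edge s m (faceWeight n k m t) w

        facePart : Subset v → ℤ
        facePart H = (value F Sub.⊆? H) ▹ interval (λ m → weight ∣ H ∣ m w) (∣ H ∣ ∸ s) s

        ζ̄-⋆ : ζ-value (face F) ⋆ ≡ ∑ faces (λ H → (value F Sub.⊆? H) ▹ share H)
        ζ̄-⋆ = begin
          1ℤ + c * χ̃-link Δ (value F)
            ≡⟨ cong₂ _+_ (sym (∑-same-size F 1ℤ)) (cong (c *_) (∑-filter (value F Sub.⊆?_) faces _)) ⟩
          ∑ faces (λ H → (value F Sub.⊆? H) ▹ (s ℕ.≟ ∣ H ∣) ▹ 1ℤ)
            + c * ∑ faces (λ H → (value F Sub.⊆? H) ▹ -1ℤ ℤ.^ suc (∣ H ∣ ∸ s))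
            ≡⟨ cong (ℤ._+_ (∑ faces (λ H → (value F Sub.⊆? H) ▹ (s ℕ.≟ ∣ H ∣) ▹ 1ℤ)))
                 (trans (sym (∑-*ˡ faces c _))
                        (∑-cong faces λ H → sym (▹-*ˡ (value F Sub.⊆? H) c _))) ⟩
          ∑ faces (λ H → (value F Sub.⊆? H) ▹ (s ℕ.≟ ∣ H ∣) ▹ 1ℤ)
            + ∑ faces (λ H → (value F Sub.⊆? H) ▹ c * -1ℤ ℤ.^ suc (∣ H ∣ ∸ s))
            ≡⟨ ∑-+ faces _ _ ⟨
          _ ≡⟨ ∑-cong faces (λ H → ▹-+ (value F Sub.⊆? H) _ _) ⟨
          ∑ faces (λ H → (value F Sub.⊆? H) ▹ share H) ∎

        star : step ⋆ ≡ ∑ faces starPart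
        star = begin
          step ⋆
            ≡⟨ ▹-⇔ (mk⇔ (λ where (face≤* s<n , _) → s<n) (λ s<n → face≤* s<n , λ ()))
                 (face F 𝐏.≺? ⋆) (s ℕ.<? n) ⟩
          -- One guard comes from the chain condition, the other from the extension of `ζ̄ˢ` by
          -- zero.
          (s ℕ.<? n) ▹ ((s ℕ.<? n) ▹ ζ-value (face F) ⋆) * edge s n (T k ⋆) w
            ≡⟨ ▹-cong (s ℕ.<? n) (λ s<n → cong₂ _*_ (trans (▹-yes (s ℕ.<? n) s<n) ζ̄-⋆)
                                                   (⊛-cong (edgePoly s n) (T-⋆ k) w)) ⟩
          (s ℕ.<? n) ▹ ∑ faces (λ H → (value F Sub.⊆? H) ▹ share H) * E
            ≡⟨ cong ((s ℕ.<? n) ▹_) (∑-*ʳ faces E _) ⟨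
          (s ℕ.<? n) ▹ ∑ faces (λ H → ((value F Sub.⊆? H) ▹ share H) * E)
            ≡⟨ ∑-▹ (s ℕ.<? n) faces _ ⟨
          ∑ faces (λ H → (s ℕ.<? n) ▹ ((value F Sub.⊆? H) ▹ share H) * E)
            ≡⟨ ∑-cong faces (λ H → trans (cong ((s ℕ.<? n) ▹_) (sym (▹-*ʳ (value F Sub.⊆? H) (share H) E)))
                                         (▹-comm (s ℕ.<? n) (value F Sub.⊆? H))) ⟩
          ∑ faces starPart ∎

        through : ∀ G → step (face G) ≡ ∑ faces (λ H →
          (value F Sub.⊆? value G) ▹ (value G Sub.⊆? H) ▹ weight ∣ H ∣ ∣ value G ∣ w)
        through G = begin
          step (face G)
            ≡⟨ strict ⟩
          F⊆?G ▹ s<?m ▹ edge s m (T k (face G)) w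
            ≡⟨ cong (λ z → F⊆?G ▹ s<?m ▹ z) (⊛-cong (edgePoly s m) (T-face k G) w) ⟩
          F⊆?G ▹ s<?m ▹ edge s m (λ w → ∑ faces λ H → (value G Sub.⊆? H) ▹ faceWeight n k m ∣ H ∣ w) w
            ≡⟨ cong (λ z → F⊆?G ▹ s<?m ▹ z) (trans
                 (⊛-∑ (edgePoly s m) faces (λ H w → (value G Sub.⊆? H) ▹ faceWeight n k m ∣ H ∣ w) w)
                 (∑-cong faces λ H → ⊛-▹ (edgePoly s m) (value G Sub.⊆? H) (faceWeight n k m ∣ H ∣) w)) ⟩
          F⊆?G ▹ s<?m ▹ ∑ faces (λ H → (value G Sub.⊆? H) ▹ edge s m (faceWeight n k m ∣ H ∣) w)
            ≡⟨ cong (F⊆?G ▹_) (∑-▹ s<?m faces _) ⟨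
          F⊆?G ▹ ∑ faces (λ H → s<?m ▹ (value G Sub.⊆? H) ▹ edge s m (faceWeight n k m ∣ H ∣) w)
            ≡⟨ ∑-▹ F⊆?G faces _ ⟨
          ∑ faces (λ H → F⊆?G ▹ s<?m ▹ (value G Sub.⊆? H) ▹ edge s m (faceWeight n k m ∣ H ∣) w)
            ≡⟨ ∑-cong faces (λ H → cong (F⊆?G ▹_) (▹-comm s<?m (value G Sub.⊆? H))) ⟩
          ∑ faces (λ H → F⊆?G ▹ (value G Sub.⊆? H) ▹ weight ∣ H ∣ m w) ∎
          where
          m     = ∣ value G ∣
          F⊆?G  = value F Sub.⊆? value G
          s<?m  = s ℕ.<? m

          X = edge s m (T k (face G)) w

          -- Once `F ⊆ G` is known, strictness amounts to `|F| < |G|`; this keeps the weight of `G`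
          -- a function of its size.
          strict : step (face G) ≡ F⊆?G ▹ s<?m ▹ X
          strict = go (face F 𝐏.≺? face G)
            where
            go : (F≺?G : Dec (face F 𝐏.≺ face G)) →
                 F≺?G ▹ ζ̄ˢ (face F) (face G) * X ≡ F⊆?G ▹ s<?m ▹ X
            go (yes F≺G@(face≤face F⊆G , _)) = begin
              (F⊆?G ▹ 1ℤ) * X     ≡⟨ cong (_* X) (▹-yes F⊆?G F⊆G) ⟩
              1ℤ * X              ≡⟨ ℤ.*-identityˡ X ⟩
              X                   ≡⟨ ▹-yes s<?m (ρˢ-mono dim<n F≺G) ⟨
              s<?m ▹ X            ≡⟨ ▹-yes F⊆?G F⊆G ⟨
              F⊆?G ▹ s<?m ▹ X     ∎
            go (no F⊀G) = sym (trans
              (▹-cong F⊆?G λ F⊆G → ▹-no s<?m λ s<m →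
                F⊀G (face≤face F⊆G , λ F≡G → ℕ.<⇒≢ s<m (cong ρˢ F≡G)))
              (▹-zero F⊆?G))

        through-faces : ∑ (allFaces Δ) (step ∘ face) ≡ ∑ faces facePart
        through-faces = begin
          ∑ (allFaces Δ) (step ∘ face)
            ≡⟨ ∑-cong (allFaces Δ) through ⟩
          ∑ (allFaces Δ) (λ G → ∑ faces (λ H →
            (value F Sub.⊆? value G) ▹ (value G Sub.⊆? H) ▹ weight ∣ H ∣ ∣ value G ∣ w))
            ≡⟨ ∑-allFaces _ ⟩
          ∑ faces (λ G → ∑ faces (λ H →
            (value F Sub.⊆? G) ▹ (G Sub.⊆? H) ▹ weight ∣ H ∣ ∣ G ∣ w))
            ≡⟨ ∑-swap faces faces _ ⟩
          ∑ faces (λ H → ∑ faces (λ G →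
            (value F Sub.⊆? G) ▹ (G Sub.⊆? H) ▹ weight ∣ H ∣ ∣ G ∣ w))
            ≡⟨ ∑-cong-∈ faces (λ {H} H∈ → below H (proj₂ (∈-filter⁻ Face? {xs = subsets v} H∈))) ⟩
          ∑ faces facePart ∎
          where
          -- Every set between `F` and `H` is a face because `H` is one, so the sum over faces `G`
          -- fills the whole Boolean interval and loses its reference to the complex.
          below : ∀ H → Face H →
            ∑ faces (λ G → (value F Sub.⊆? G) ▹ (G Sub.⊆? H) ▹ weight ∣ H ∣ ∣ G ∣ w) ≡ facePart H
          below H H∈Δ = begin
            _ ≡⟨ ∑-filter Face? (subsets v) _ ⟩
            ∑ (subsets v) (λ G → Face? G ▹ (value F Sub.⊆? G) ▹ (G Sub.⊆? H) ▹ weight ∣ H ∣ ∣ G ∣ w)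
              ≡⟨ ∑-cong (subsets v) (λ G → trans
                   (▹-comm (Face? G) (value F Sub.⊆? G))
                   (cong ((value F Sub.⊆? G) ▹_) (trans (▹-comm (Face? G) (G Sub.⊆? H))
                     (▹-cong (G Sub.⊆? H) λ G⊆H → ▹-yes (Face? G) (down-closed G⊆H H∈Δ))))) ⟩
            ∑ (subsets v) (λ G → (value F Sub.⊆? G) ▹ (G Sub.⊆? H) ▹ weight ∣ H ∣ ∣ G ∣ w)
              ≡⟨ ∑-between-▹ (λ m → weight ∣ H ∣ m w) (value F) H ⟩
            facePart H ∎

    -- The series is the same for all complexes on all vertex sets; through it the given complex is
    -- compared with the components.
    coeff-Ψ-Semi : ∀ w →
      coeff (Ψ-Semi Δ n 1≤n dim<n) w ≡ ∑ faces (λ H → faceSeries n ∣ H ∣ w)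
    coeff-Ψ-Semi w = begin
      coeff (Ψ-Semi Δ n 1≤n dim<n) w
        ≡⟨ coeff-Ψ (poset dim<n) (bounded dim<n 1≤n) w ⟩
      ∑ (upTo (suc n ∸ ∣ ⊥ {v} ∣)) (λ k → T k ∅ᶠ w)
        ≡⟨ cong (λ s → ∑ (upTo (suc n ∸ s)) (λ k → T k ∅ᶠ w)) (Sub.∣⊥∣≡0 v) ⟩
      ∑ (upTo (suc n)) (λ k → T k ∅ᶠ w)
        ≡⟨ ∑-cong (upTo (suc n)) (λ k → trans
             (T-face k (record { value = ⊥ ; proof = [ ∅-face ] }) w) (∑-cong faces λ H → trans
             (▹-yes (⊥ Sub.⊆? H) (Sub.⊆-min H))
             (cong (λ s → faceWeight n k s ∣ H ∣ w) (Sub.∣⊥∣≡0 v)))) ⟩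
      ∑ (upTo (suc n)) (λ k → ∑ faces (λ H → faceWeight n k 0 ∣ H ∣ w))
        ≡⟨ ∑-swap (upTo (suc n)) faces _ ⟩
      ∑ faces (λ H → faceSeries n ∣ H ∣ w) ∎

-- Shellings

⊈⇒∃ : ∀ {v} {p q : Subset v} → ¬ p ⊆ q → ∃ λ x → x ∈ˢ p × x ∉ˢ q
⊈⇒∃ {p = p} {q} p⊈q with Fin.any? (λ x → x Sub.∈? p ×-dec ¬? (x Sub.∈? q))
... | yes x∈p∖q = x∈p∖q
... | no  none  = contradiction
  (λ {x} x∈p → decidable-stable (x Sub.∈? q) λ x∉q → none (x , x∈p , x∉q)) p⊈q

x∉p-x : ∀ {v} (p : Subset v) x → x ∉ˢ p - x
x∉p-x (_ ∷ p) zero    ()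
x∉p-x (_ ∷ p) (suc x) (Vec.there x∈) = x∉p-x p x x∈

-‿injective : ∀ {v} {p : Subset v} {x y} → x ∈ˢ p → p - x ≡ p - y → x ≡ y
-‿injective {p = p} {x} {y} x∈p eq with x Fin.≟ y
... | yes x≡y = x≡y
... | no  x≢y = contradiction (subst (x ∈ˢ_) (sym eq) (Sub.x∈p∧x≢y⇒x∈p-y x∈p x≢y)) (x∉p-x p x)

⊆- : ∀ {v} {p q : Subset v} {x} → p ⊆ q → x ∉ˢ p → p ⊆ q - x
⊆- p⊆q x∉p y∈p = Sub.x∈p∧x≢y⇒x∈p-y (p⊆q y∈p) λ where refl → x∉p y∈p

allFin-suc : ∀ m (f : Fin (suc m) → ℤ) → ∑ (allFin (suc m)) f ≡ f zero + ∑ (allFin m) (f ∘ suc)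
allFin-suc m f = cong (ℤ._+_ (f zero)) (trans
  (cong (λ xs → ∑ xs f) (sym (List.map-tabulate id suc))) (∑-map suc (allFin m) f))

∑-members : ∀ {v} (p : Subset v) → ∑ (allFin v) (λ x → (x Sub.∈? p) ▹ 1ℤ) ≡ + ∣ p ∣
∑-members []                = refl
∑-members {suc v} (s ∷ p) = trans (allFin-suc v (λ x → (x Sub.∈? (s ∷ p)) ▹ 1ℤ)) (trans
  (cong (ℤ._+_ ((zero Sub.∈? (s ∷ p)) ▹ 1ℤ)) (trans
    (∑-cong (allFin v) λ x → ▹-⇔ (mk⇔ Sub.drop-there Vec.there) (suc x Sub.∈? (s ∷ p)) (x Sub.∈? p))
    (∑-members p)))
  (head s))
  where
  head : ∀ s → ((zero Sub.∈? (s ∷ p)) ▹ 1ℤ) + + ∣ p ∣ ≡ + ∣ s ∷ p ∣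
  head outside = refl
  head inside  = refl

∑-telescope : ∀ m (S : ℕ → ℤ) (t : Fin m → ℤ) → (∀ r → S (suc (toℕ r)) ≡ S (toℕ r) + t r) →
              S m ≡ S 0 + ∑ (allFin m) t
∑-telescope zero    S t step = sym (ℤ.+-identityʳ (S 0))
∑-telescope (suc m) S t step = begin
  S (suc m)                                    ≡⟨ ∑-telescope m (S ∘ suc) (t ∘ suc) (step ∘ suc) ⟩
  S 1 + ∑ (allFin m) (t ∘ suc)                 ≡⟨ cong (_+ ∑ (allFin m) (t ∘ suc)) (step zero) ⟩
  S 0 + t zero + ∑ (allFin m) (t ∘ suc)        ≡⟨ ℤ.+-assoc (S 0) (t zero) _ ⟩
  S 0 + (t zero + ∑ (allFin m) (t ∘ suc))      ≡⟨ cong (ℤ._+_ (S 0)) (allFin-suc m t) ⟨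
  S 0 + ∑ (allFin (suc m)) t                   ∎

∑-allFin-δ : ∀ {m J} (f : ℕ → ℤ) → J ≤ m →
  ∑ (allFin (suc m)) (λ i → (J ℕ.≟ toℕ i) ▹ f (toℕ i)) ≡ f J
∑-allFin-δ {m} {J} f J≤m = trans
  (∑-δ (λ i → J ℕ.≟ toℕ i) (allFin (suc m)) (f ∘ toℕ) (Unique.allFin⁺ (suc m))
    (∈-allFin (fromℕ< J<1+m)) (sym (Fin.toℕ-fromℕ< J<1+m))
    (λ J≡i → Fin.toℕ-injective (trans (sym J≡i) (sym (Fin.toℕ-fromℕ< J<1+m)))))
  (cong f (Fin.toℕ-fromℕ< J<1+m))
  where J<1+m = s≤s J≤m

maximal-above : ∀ {v} {𝓕 : Pred (Subset v) 0ℓ} → Decidable 𝓕 → ∀ {G} → 𝓕 G →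
                ∃ λ M → Maximal 𝓕 M × G ⊆ M
maximal-above {v} {𝓕} 𝓕? {G} G∈𝓕 = climb v G∈𝓕 (ℕ.m≤n+m v ∣ G ∣)
  where
  -- `d` is fuel: each strict enlargement costs one unit and preserves `v ≤ |G| + d`. With no fuel
  -- left, `G` already has `v` vertices and nothing is larger.
  climb : ∀ d {G} → 𝓕 G → v ≤ ∣ G ∣ ℕ.+ d → ∃ λ M → Maximal 𝓕 M × G ⊆ M
  climb d {G} G∈𝓕 v≤ with Sub.anySubset? (λ H → 𝓕? H ×-dec (G Sub.⊂? H))
  ... | no  none = G , (G∈𝓕 , none) , Sub.⊆-refl
  climb zero {G} G∈𝓕 v≤ | yes (H , _ , G⊂H) = contradiction
    (ℕ.≤-trans (Sub.∣p∣≤n H) (subst (v ≤_) (ℕ.+-identityʳ _) v≤)) (ℕ.<⇒≱ (Sub.p⊂q⇒∣p∣<∣q∣ G⊂H))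
  climb (suc d) {G} G∈𝓕 v≤ | yes (H , H∈𝓕 , G⊂H)
    with M , M-max , H⊆M ← climb d H∈𝓕 (ℕ.≤-trans (subst (v ≤_) (ℕ.+-suc _ d) v≤)
                                         (ℕ.+-monoˡ-≤ d (Sub.p⊂q⇒∣p∣<∣q∣ G⊂H)))
    = M , M-max , Sub.⊆-trans (proj₁ G⊂H) H⊆M

-- The last hypothesis makes `R` the least face of `F` outside `𝓐`, so the new faces are those
-- between `R` and `F`. Facets of a shelling and facets of `Δ_{k,i}` are both added through this
-- lemma, which is why their contributions agree.
∑-adjoin : ∀ {v} (φ : ℕ → ℤ) {𝓐 𝓑 : Pred (Subset v) 0ℓ} (𝓐? : Decidable 𝓐) (𝓑? : Decidable 𝓑)
  (R F : Subset v) → R ⊆ F → (∀ G → 𝓑 G ⇔ (𝓐 G ⊎ G ⊆ F)) → (∀ G → G ⊆ F → 𝓐 G ⇔ (¬ R ⊆ G)) →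
  ∑ (subsets v) (λ G → 𝓑? G ▹ φ ∣ G ∣) ≡
  ∑ (subsets v) (λ G → 𝓐? G ▹ φ ∣ G ∣) + interval φ (∣ F ∣ ∸ ∣ R ∣) ∣ R ∣
∑-adjoin {v} φ {𝓐} {𝓑} 𝓐? 𝓑? R F R⊆F 𝓑⇔ 𝓐⇔ = begin
  ∑ (subsets v) (λ G → 𝓑? G ▹ φ ∣ G ∣)
    ≡⟨ ∑-cong (subsets v) split ⟩
  ∑ (subsets v) (λ G → (𝓐? G ▹ φ ∣ G ∣) + between φ R F G)
    ≡⟨ ∑-+ (subsets v) _ _ ⟩
  ∑ (subsets v) (λ G → 𝓐? G ▹ φ ∣ G ∣) + ∑ (subsets v) (between φ R F)
    ≡⟨ cong (ℤ._+_ (∑ (subsets v) (λ G → 𝓐? G ▹ φ ∣ G ∣))) (∑-between φ R F R⊆F) ⟩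
  ∑ (subsets v) (λ G → 𝓐? G ▹ φ ∣ G ∣) + interval φ (∣ F ∣ ∸ ∣ R ∣) ∣ R ∣ ∎
  where
  open Equivalence
  neither : ∀ G → ¬ 𝓐 G → ¬ G ⊆ F → ¬ 𝓑 G
  neither G ¬𝓐G G⊈F 𝓑G with to (𝓑⇔ G) 𝓑G
  ... | inj₁ 𝓐G  = ¬𝓐G 𝓐G
  ... | inj₂ G⊆F = G⊈F G⊆F

  split : ∀ G → 𝓑? G ▹ φ ∣ G ∣ ≡ (𝓐? G ▹ φ ∣ G ∣) + between φ R F G
  split G with 𝓐? G | R Sub.⊆? G | G Sub.⊆? F
  ... | yes 𝓐G | yes R⊆G | yes G⊆F = ⊥-elim (to (𝓐⇔ G G⊆F) 𝓐G R⊆G)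
  ... | yes 𝓐G | yes _   | no  _   = trans (▹-yes (𝓑? G) (from (𝓑⇔ G) (inj₁ 𝓐G))) (sym (ℤ.+-identityʳ _))
  ... | yes 𝓐G | no  _   | _       = trans (▹-yes (𝓑? G) (from (𝓑⇔ G) (inj₁ 𝓐G))) (sym (ℤ.+-identityʳ _))
  ... | no  _  | yes _   | yes G⊆F = trans (▹-yes (𝓑? G) (from (𝓑⇔ G) (inj₂ G⊆F))) (sym (ℤ.+-identityˡ _))
  ... | no ¬𝓐G | yes _   | no  G⊈F = ▹-no (𝓑? G) (neither G ¬𝓐G G⊈F)
  ... | no ¬𝓐G | no  R⊈G | _       = ▹-no (𝓑? G) (neither G ¬𝓐G λ G⊆F → ¬𝓐G (from (𝓐⇔ G G⊆F) R⊈G))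

-- F is a facet attached to the complex 𝓛 along a complex pure of codimension
-- one. Its restriction is the least face of F that does not lie in 𝓛.
module Restriction {v} {𝓛 : Pred (Subset v) 0ℓ} (𝓛? : Decidable 𝓛)
  (𝓛-down : ∀ {G H} → G ⊆ H → 𝓛 H → 𝓛 G) (F : Subset v)
  (pure : ∀ M → Maximal (λ G → 𝓛 G × G ⊆ F) M → suc ∣ M ∣ ≡ ∣ F ∣) where

  private
    member? : ∀ x → Dec (x ∈ˢ F × 𝓛 (F - x))
    member? x = x Sub.∈? F ×-dec 𝓛? (F - x)

  restriction : Subset v
  restriction = Vec.tabulate (does ∘ member?)

  ∈-restriction : ∀ {x} → x ∈ˢ restriction ⇔ (x ∈ˢ F × 𝓛 (F - x))
  ∈-restriction {x} = mk⇔
    (λ x∈ → toMember (member? x) (trans (sym (Vec.lookup∘tabulate _ x)) (Vec.[]=⇒lookup x∈)))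
    (λ m → Vec.lookup⇒[]= x restriction (trans (Vec.lookup∘tabulate _ x) (dec-true (member? x) m)))
    where
    toMember : (P? : Dec P) → does P? ≡ true → P
    toMember (yes p) _ = p

  open module E {x} = Equivalence (∈-restriction {x})
    renaming (to to ∈-restriction⁻; from to ∈-restriction⁺)

  restriction⊆F : restriction ⊆ F
  restriction⊆F = proj₁ ∘ ∈-restriction⁻

  -- Otherwise `F` would itself be the maximal face of the intersection, in codimension zero.
  F∉𝓛 : ¬ 𝓛 F
  F∉𝓛 F∈𝓛 = ℕ.1+n≢n (pure F ((F∈𝓛 , Sub.⊆-refl) , λ (G , (_ , G⊆F) , F⊂G) →
    ℕ.<⇒≱ (Sub.p⊂q⇒∣p∣<∣q∣ F⊂G) (Sub.p⊆q⇒∣p∣≤∣q∣ G⊆F)))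

  maximal⁻ : ∀ {M} → Maximal (λ G → 𝓛 G × G ⊆ F) M → ∃ λ x → x ∈ˢ restriction × M ≡ F - x
  maximal⁻ {M} M-max@((M∈𝓛 , M⊆F) , _)
    with x , x∈F , x∉M ← ⊈⇒∃ {p = F} {M} (λ F⊆M →
           ℕ.<⇒≱ (ℕ.≤-reflexive (pure M M-max)) (Sub.p⊆q⇒∣p∣≤∣q∣ F⊆M))
    = x , ∈-restriction⁺ (x∈F , subst 𝓛 M≡F-x M∈𝓛) , M≡F-x
    where
    M≡F-x : M ≡ F - x
    M≡F-x = ⊆∧size⇒≡ (⊆- M⊆F x∉M) (ℕ.≤-antisym (Sub.p⊆q⇒∣p∣≤∣q∣ (⊆- {x = x} M⊆F x∉M))
      (ℕ.s≤s⁻¹ (subst (∣ F - x ∣ <_) (sym (pure M M-max)) (Sub.x∈p⇒∣p-x∣<∣p∣ x∈F))))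

  -- The only larger face of `F` is `F`, which does not lie in `𝓛`.
  maximal⁺ : ∀ {x} → x ∈ˢ restriction → Maximal (λ G → 𝓛 G × G ⊆ F) (F - x)
  maximal⁺ {x} x∈R with x∈F , F-x∈𝓛 ← ∈-restriction⁻ x∈R =
    (F-x∈𝓛 , Sub.p─q⊆p F ⁅ x ⁆) , λ (G , (G∈𝓛 , G⊆F) , F-x⊆G , y , y∈G , y∉F-x) →
      let x∈G : x ∈ˢ G
          x∈G = subst (_∈ˢ G) (decidable-stable (y Fin.≟ x) λ y≢x →
                  y∉F-x (Sub.x∈p∧x≢y⇒x∈p-y (G⊆F y∈G) y≢x)) y∈G
          F⊆G : F ⊆ G
          F⊆G {z} z∈F = case-≟ z z∈F x∈G F-x⊆G
      in F∉𝓛 (𝓛-down F⊆G G∈𝓛)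
    where
    case-≟ : ∀ z {G} → z ∈ˢ F → x ∈ˢ G → F - x ⊆ G → z ∈ˢ G
    case-≟ z z∈F x∈G F-x⊆G with z Fin.≟ x
    ... | yes refl = x∈G
    ... | no z≢x   = F-x⊆G (Sub.x∈p∧x≢y⇒x∈p-y z∈F z≢x)

  -- A face in `𝓛` extends to a maximal one, which by purity is `F - x` with `x` in the restriction,
  -- so it misses `x`. Conversely, missing such an `x` places a face of `F` inside `F - x`.
  𝓛⇔⊉restriction : ∀ G → G ⊆ F → 𝓛 G ⇔ (¬ restriction ⊆ G)
  𝓛⇔⊉restriction G G⊆F = mk⇔ to from
    where
    to : 𝓛 G → ¬ restriction ⊆ G
    to G∈𝓛 R⊆G with maximal-above (λ H → 𝓛? H ×-dec (H Sub.⊆? F)) (G∈𝓛 , λ {x} → G⊆F {x})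
    ... | M , M-max , G⊆M with maximal⁻ M-max
    ... | x , x∈R , refl = x∉p-x F x (G⊆M (R⊆G x∈R))
    from : ¬ restriction ⊆ G → 𝓛 G
    from R⊈G with x , x∈R , x∉G ← ⊈⇒∃ {p = restriction} {G} (λ R⊆G → R⊈G R⊆G) =
      𝓛-down (⊆- G⊆F x∉G) (proj₂ (∈-restriction⁻ x∈R))

  -- Double counting along the bijection `x ↦ F - x` from the restriction to the facets of the
  -- intersection. The decision procedure is arbitrary, so that the one in `shellingType` can be
  -- inserted.
  ∣restriction∣ : (max? : Decidable (Maximal (λ G → 𝓛 G × G ⊆ F))) →
                  length (filter max? (subsets v)) ≡ ∣ restriction ∣
  ∣restriction∣ max? = ℤ.+-injective (begin
    + length (filter max? (subsets v))
      ≡⟨ ∑-length (filter max? (subsets v)) ⟨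
    ∑ (filter max? (subsets v)) (λ _ → 1ℤ)
      ≡⟨ ∑-filter max? (subsets v) _ ⟩
    ∑ (subsets v) (λ G → max? G ▹ 1ℤ)
      ≡⟨ ∑-cong (subsets v) by-vertex ⟩
    ∑ (subsets v) (λ G → ∑ (allFin v) λ x → (x Sub.∈? restriction) ▹ (G ≟ˢ (F - x)) ▹ 1ℤ)
      ≡⟨ ∑-swap (subsets v) (allFin v) _ ⟩
    ∑ (allFin v) (λ x → ∑ (subsets v) λ G → (x Sub.∈? restriction) ▹ (G ≟ˢ (F - x)) ▹ 1ℤ)
      ≡⟨ ∑-cong (allFin v) (λ x → trans (∑-▹ (x Sub.∈? restriction) (subsets v) _)
           (cong ((x Sub.∈? restriction) ▹_) (∑-δ (_≟ˢ (F - x)) (subsets v) (λ _ → 1ℤ)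
             (subsets-unique v) (∈-subsets (F - x)) refl id))) ⟩
    ∑ (allFin v) (λ x → (x Sub.∈? restriction) ▹ 1ℤ)
      ≡⟨ ∑-members restriction ⟩
    + ∣ restriction ∣ ∎)
    where
    _≟ˢ_ = Vec.≡-dec {n = v} Bool._≟_

    by-vertex : ∀ G → max? G ▹ 1ℤ ≡
      ∑ (allFin v) (λ x → (x Sub.∈? restriction) ▹ (G ≟ˢ (F - x)) ▹ 1ℤ)
    by-vertex G with max? G
    ... | no ¬max = sym (∑-zero (allFin v) λ {x} _ → trans
      (▹-cong (x Sub.∈? restriction) λ x∈R → ▹-no (G ≟ˢ (F - x)) λ G≡ →
        ¬max (subst (Maximal _) (sym G≡) (maximal⁺ x∈R)))
      (▹-zero (x Sub.∈? restriction)))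
    ... | yes G-max with x₀ , x₀∈R , refl ← maximal⁻ G-max = sym (trans
      (∑-cong (allFin v) λ x → sym (▹-× (x Sub.∈? restriction) (G ≟ˢ (F - x))))
      (∑-δ (λ x → (x Sub.∈? restriction) ×-dec (G ≟ˢ (F - x))) (allFin v) (λ _ → 1ℤ)
        (Unique.allFin⁺ v) (∈-allFin x₀) (x₀∈R , refl)
        λ (x∈R , eq) → -‿injective (restriction⊆F x∈R) (sym eq)))

-- The complexes `Δ_{k,i}` and the polynomials `Φ̌`

open SimplicialComplex
open Equivalence

-- Plays the role of the restriction of the facet opposite `i`: a face of that facet is new when it
-- contains every vertex below `i`.
initial : ∀ {v} → Fin v → Subset v
initial {suc v} zero    = ⊥
initial {suc v} (suc i) = inside ∷ initial i

∣initial∣ : ∀ {v} (i : Fin v) → ∣ initial i ∣ ≡ toℕ i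
∣initial∣ {suc v} zero    = Sub.∣⊥∣≡0 (suc v)
∣initial∣ {suc v} (suc i) = cong suc (∣initial∣ i)

∈-initial⁺ : ∀ {v} {i x : Fin v} → toℕ x < toℕ i → x ∈ˢ initial i
∈-initial⁺ {suc v} {suc i} {zero}  _         = Vec.here
∈-initial⁺ {suc v} {suc i} {suc x} (s≤s x<i) = Vec.there (∈-initial⁺ x<i)

∈-initial⁻ : ∀ {v} {i x : Fin v} → x ∈ˢ initial i → toℕ x < toℕ i
∈-initial⁻ {suc v} {zero}  {x}     x∈            = ⊥-elim (Sub.∉⊥ x∈)
∈-initial⁻ {suc v} {suc i} {zero}  _             = s≤s z≤n
∈-initial⁻ {suc v} {suc i} {suc x} (Vec.there x∈) = s≤s (∈-initial⁻ x∈)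

⊆∁⁅⁆⁺ : ∀ {v} {G : Subset v} {x} → x ∉ˢ G → G ⊆ ∁ ⁅ x ⁆
⊆∁⁅⁆⁺ {x = x} x∉G {y} y∈G = Sub.x∉p⇒x∈∁p λ y∈⁅x⁆ →
  x∉G (subst (_∈ˢ _) (Sub.x∈⁅y⁆⇒x≡y x y∈⁅x⁆) y∈G)

⊆∁⁅⁆⁻ : ∀ {v} {G : Subset v} {x} → G ⊆ ∁ ⁅ x ⁆ → x ∉ˢ G
⊆∁⁅⁆⁻ {x = x} G⊆ x∈G = Sub.x∈∁p⇒x∉p (G⊆ x∈G) (Sub.x∈⁅x⁆ x)

-- Membership in the union of the facets opposite the vertices below `m`. Unlike `component`, it
-- allows `m = 0`, the empty family, so that the first facet is added like any other.
Misses : ∀ {v} → ℕ → Pred (Subset v) 0ℓ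
Misses {v} m G = ∃ λ (x : Fin v) → toℕ x < m × x ∉ˢ G

Misses? : ∀ {v} m → Decidable (Misses {v} m)
Misses? m G = Fin.any? λ x → toℕ x ℕ.<? m ×-dec ¬? (x Sub.∈? G)

component-face : ∀ {k} (i : Fin (suc k)) G → Face (component k i) G ⇔ Misses (suc (toℕ i)) G
component-face i G = mk⇔
  (λ (j , G⊆) → inject≤ j (Fin.toℕ<n i)
              , subst (_< suc (toℕ i)) (sym (Fin.toℕ-inject≤ j (Fin.toℕ<n i))) (Fin.toℕ<n j)
              , ⊆∁⁅⁆⁻ G⊆)
  (λ (x , x≤i , x∉G) → fromℕ< x≤i , ⊆∁⁅⁆⁺ (subst (_∉ˢ G)
    (Fin.toℕ-injective (sym (trans (Fin.toℕ-inject≤ (fromℕ< x≤i) (Fin.toℕ<n i))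
                                (Fin.toℕ-fromℕ< x≤i)))) x∉G))

∣∁⁅⁆∣ : ∀ {k} (i : Fin (suc k)) → ∣ ∁ ⁅ i ⁆ ∣ ≡ k
∣∁⁅⁆∣ i = trans (Sub.∣∁p∣≡n∸∣p∣ ⁅ i ⁆) (cong (suc _ ∸_) (Sub.∣⁅x⁆∣≡1 i))

∑-component : ∀ {k} (φ : ℕ → ℤ) (i : Fin (suc k)) → ∑ (faces (component k i)) (φ ∘ ∣_∣) ≡
  ∑ (subsets (suc k)) (λ G → Misses? (toℕ i) G ▹ φ ∣ G ∣) + interval φ (k ∸ toℕ i) (toℕ i)
∑-component {k} φ i = begin
  ∑ (faces (component k i)) (φ ∘ ∣_∣)
    ≡⟨ ∑-filter (Face? (component k i)) (subsets (suc k)) _ ⟩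
  ∑ (subsets (suc k)) (λ G → Face? (component k i) G ▹ φ ∣ G ∣)
    ≡⟨ ∑-adjoin φ (Misses? (toℕ i)) (Face? (component k i)) (initial i) (∁ ⁅ i ⁆)
         (⊆∁⁅⁆⁺ λ i∈ → ℕ.n≮n _ (∈-initial⁻ i∈)) face⇔ misses⇔ ⟩
  old + interval φ (∣ ∁ ⁅ i ⁆ ∣ ∸ ∣ initial i ∣) ∣ initial i ∣
    ≡⟨ cong₂ (λ d m → old + interval φ (d ∸ m) m) (∣∁⁅⁆∣ i) (∣initial∣ i) ⟩
  old + interval φ (k ∸ toℕ i) (toℕ i) ∎
  where
  old = ∑ (subsets (suc k)) (λ G → Misses? (toℕ i) G ▹ φ ∣ G ∣)

  face⇔ : ∀ G → Face (component k i) G ⇔ (Misses (toℕ i) G ⊎ G ⊆ ∁ ⁅ i ⁆)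
  face⇔ G = mk⇔ (λ f → split (to (component-face i G) f)) (λ m → from (component-face i G) (join m))
    where
    split : Misses (suc (toℕ i)) G → Misses (toℕ i) G ⊎ G ⊆ ∁ ⁅ i ⁆
    split (x , x≤i , x∉G) with toℕ x ℕ.≟ toℕ i
    ... | yes x≡i = inj₂ (⊆∁⁅⁆⁺ (subst (_∉ˢ G) (Fin.toℕ-injective x≡i) x∉G))
    ... | no  x≢i = inj₁ (x , ℕ.≤∧≢⇒< (ℕ.s≤s⁻¹ x≤i) x≢i , x∉G)
    join : Misses (toℕ i) G ⊎ G ⊆ ∁ ⁅ i ⁆ → Misses (suc (toℕ i)) G
    join (inj₁ (x , x<i , x∉G)) = x , ℕ.m<n⇒m<1+n x<i , x∉G
    join (inj₂ G⊆) = i , ℕ.≤-refl , ⊆∁⁅⁆⁻ G⊆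

  misses⇔ : ∀ G → G ⊆ ∁ ⁅ i ⁆ → Misses (toℕ i) G ⇔ (¬ initial i ⊆ G)
  misses⇔ G _ = mk⇔
    (λ (x , x<i , x∉G) R⊆G → x∉G (R⊆G (∈-initial⁺ x<i)))
    (λ R⊈G → let x , x∈R , x∉G = ⊈⇒∃ {p = initial i} {G} R⊈G in x , ∈-initial⁻ x∈R , x∉G)

-- The facet opposite `i` is the last one of `Δ_{k,i}`, and subtracting the complex before it leaves
-- its Boolean interval. For `i = 0` there is nothing to subtract, in agreement with the separate
-- clause of `Φ̌`.
coeff-Φ̌ : ∀ n k i 1≤n k≤n w →
  coeff (Φ̌ n k i 1≤n k≤n) w ≡ interval (λ t → faceSeries n t w) (k ∸ toℕ i) (toℕ i)
coeff-Φ̌ n k zero 1≤n k≤n w = begin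
  coeff (Ψ-P n k zero 1≤n k≤n) w
    ≡⟨ coeff-Ψ-Semi (component k zero) n 1≤n (component-dim zero k≤n) w ⟩
  ∑ (faces (component k zero)) (λ H → faceSeries n ∣ H ∣ w)
    ≡⟨ ∑-component {k} φ zero ⟩
  ∑ (subsets (suc k)) (λ G → Misses? 0 G ▹ φ ∣ G ∣) + interval φ k 0
    ≡⟨ cong (_+ interval φ k 0) (∑-zero (subsets (suc k)) λ {G} _ →
         ▹-no (Misses? 0 G) λ where (_ , () , _)) ⟩
  0ℤ + interval φ k 0
    ≡⟨ ℤ.+-identityˡ _ ⟩
  interval φ k 0 ∎
  where φ = λ t → faceSeries n t w
coeff-Φ̌ n k (suc i) 1≤n k≤n w = begin
  coeff (Ψ-P n k (suc i) 1≤n k≤n -ᵖ Ψ-P n k (inject₁ i) 1≤n k≤n) w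
    ≡⟨ coeff-++ (Ψ-P n k (suc i) 1≤n k≤n) _ w ⟩
  coeff (Ψ-P n k (suc i) 1≤n k≤n) w + coeff (-1ℤ · Ψ-P n k (inject₁ i) 1≤n k≤n) w
    ≡⟨ cong₂ _+_ (trans (Ψ-P-∑ (suc i)) (∑-component φ (suc i)))
         (trans (coeff-· -1ℤ (Ψ-P n k (inject₁ i) 1≤n k≤n) w) (cong (-1ℤ *_) (Ψ-P-∑ (inject₁ i)))) ⟩
  ∑ (subsets (suc k)) (λ G → Misses? (suc (toℕ i)) G ▹ φ ∣ G ∣) + I + -1ℤ * X
    ≡⟨ cong (λ z → z + I + -1ℤ * X) old ⟩
  X + I + -1ℤ * X
    ≡⟨ cong₂ _+_ (ℤ.+-comm X I) (ℤ.-1*i≡-i X) ⟩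
  I + X ℤ.- X
    ≡⟨ ℤ.+-assoc I X _ ⟩
  I + (X ℤ.- X)
    ≡⟨ cong (ℤ._+_ I) (ℤ.+-inverseʳ X) ⟩
  I + 0ℤ
    ≡⟨ ℤ.+-identityʳ I ⟩
  I ∎
  where
  φ = λ t → faceSeries n t w
  I = interval φ (k ∸ suc (toℕ i)) (suc (toℕ i))
  X = ∑ (faces (component k (inject₁ i))) (φ ∘ ∣_∣)

  Ψ-P-∑ : ∀ j → coeff (Ψ-P n k j 1≤n k≤n) w ≡ ∑ (faces (component k j)) (φ ∘ ∣_∣)
  Ψ-P-∑ j = coeff-Ψ-Semi (component k j) n 1≤n (component-dim j k≤n) w

  old : ∑ (subsets (suc k)) (λ G → Misses? (suc (toℕ i)) G ▹ φ ∣ G ∣) ≡ X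
  old = sym (trans (∑-filter (Face? (component k (inject₁ i))) (subsets (suc k)) _)
    (∑-cong (subsets (suc k)) λ G → ▹-⇔
      (subst (λ m → Face (component k (inject₁ i)) G ⇔ Misses (suc m) G) (Fin.toℕ-inject₁ i)
        (component-face (inject₁ i) G))
      (Face? (component k (inject₁ i)) G) (Misses? (suc (toℕ i)) G)))

-- Contributions of the facets in a shelling order

∈-take⇒≢lookup : ∀ {xs : List A} → Unique xs → ∀ r {x} → x ∈ take (toℕ r) xs → x ≢ lookup xs r
∈-take⇒≢lookup (x# ∷ _) (suc r) (here refl) = All.lookup x# (∈-lookup r)
∈-take⇒≢lookup (_ ∷ u)  (suc r) (there x∈)  = ∈-take⇒≢lookup u r x∈

∈-take⇒∈ : ∀ m {xs : List A} {x} → x ∈ take m xs → x ∈ xs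
∈-take⇒∈ (suc m) {_ ∷ _} (here eq)  = here eq
∈-take⇒∈ (suc m) {_ ∷ _} (there x∈) = there (∈-take⇒∈ m x∈)

any-take⇒1≤ : ∀ m {xs : List A} {R : Pred A ℓ} → Any R (take m xs) → 1 ≤ m
any-take⇒1≤ (suc m) _ = s≤s z≤n

module Shelling {v} (Δ : SimplicialComplex v) (Fs : List (Subset v))
  (shelled : IsShellingOrder Δ Fs) where
  open IsShellingOrder shelled

  facet-face : ∀ {F} → F ∈ Fs → Face Δ F
  facet-face F∈ = proj₁ (to (facets _) F∈)

  face⇔below-facet : ∀ G → Face Δ G ⇔ Any (G ⊆_) Fs
  face⇔below-facet G = mk⇔
    (λ G∈Δ → let M , M-max , G⊆M = maximal-above (Face? Δ) G∈Δ in
      lose {P = G ⊆_} (from (facets M) M-max) (λ {x} → G⊆M {x}))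
    (λ below → let F , F∈ , G⊆F = find {P = G ⊆_} below in down-closed Δ G⊆F (facet-face F∈))

  -- In positive dimension this is the shelling condition. In dimension zero facets have at most one
  -- vertex, and `M` is a proper subset of `F`: otherwise `F` would lie in an earlier facet, hence
  -- equal it by maximality, against distinctness. So `M` is empty and `F` a single vertex.
  attaching-size : ∀ r M → Maximal (Attaching Fs r) M → suc ∣ M ∣ ≡ ∣ lookup Fs r ∣
  attaching-size r M M-max@((earlier , M⊆F) , _) with shelling
  ... | inj₂ (_ , pure) = ℤ.+-injective (begin
    1ℤ + + ∣ M ∣                     ≡⟨ cong (ℤ._+_ 1ℤ)
                                        (∙-cancelʳ ℤ.+-0-abelianGroup -1ℤ (+ ∣ M ∣) (dimF (lookup Fs r))
                                          -- `M` lies below an earlier facet, so `r` is not the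
                                          -- first index and the condition applies.
                                          (pure r (any-take⇒1≤ (toℕ r) earlier) M M-max)) ⟩
    1ℤ + (+ ∣ lookup Fs r ∣ ℤ.- 1ℤ)  ≡⟨ ℤ.+-comm 1ℤ (dimF (lookup Fs r)) ⟩
    + ∣ lookup Fs r ∣ ℤ.- 1ℤ + 1ℤ    ≡⟨ ℤ.+-assoc (+ ∣ lookup Fs r ∣) -1ℤ 1ℤ ⟩
    + ∣ lookup Fs r ∣ + 0ℤ           ≡⟨ ℤ.+-identityʳ _ ⟩
    + ∣ lookup Fs r ∣                ∎)
  ... | inj₁ dim≡0 = ℕ.≤-antisym (Sub.p⊂q⇒∣p∣<∣q∣ (M⊆F , x , x∈F , x∉M))
    (ℕ.≤-trans (face-size Δ (subst (ℤ._< 1ℤ) (sym dim≡0) (ℤ.+<+ ℕ.≤-refl))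
                           (facet-face (∈-lookup r))) (s≤s z≤n))
    where
    F = lookup Fs r
    F⊈M : ¬ F ⊆ M
    F⊈M F⊆M with F′ , F′∈ , M⊆F′ ← find {P = M ⊆_} earlier = ∈-take⇒≢lookup distinct r F′∈
      (sym (Sub.⊆-antisym F⊆F′ (decidable-stable (F′ Sub.⊆? F) λ F′⊈F →
        proj₂ (to (facets F) (∈-lookup r))
            (F′ , facet-face (∈-take⇒∈ (toℕ r) F′∈) , F⊆F′ , ⊈⇒∃ F′⊈F))))
      where
      F⊆F′ : F ⊆ F′
      F⊆F′ x∈F = M⊆F′ (F⊆M x∈F)
    new = ⊈⇒∃ {p = F} {M} F⊈M
    x   = proj₁ new
    x∈F = proj₁ (proj₂ new)
    x∉M = proj₂ (proj₂ new)

  module _ (r : Fin (length Fs)) where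
    -- For the first facet the earlier family is empty and does not even contain `∅`; the
    -- restriction is then empty and all faces of the facet are new.
    open Restriction (λ G → any? (G Sub.⊆?_) (take (toℕ r) Fs))
      (λ G⊆H → Any.map λ H⊆F {x} x∈G → H⊆F (G⊆H x∈G)) (lookup Fs r) (attaching-size r) public

    shellingType-restriction : proj₂ (shellingType Fs r) ≡ ∣ restriction ∣
    shellingType-restriction = ∣restriction∣ (Maximal? (Attaching? Fs r))

    -- Ensures that no shelling type falls outside the triangle `i ≤ k` of the double sum.
    shellingType₂≤₁ : proj₂ (shellingType Fs r) ≤ proj₁ (shellingType Fs r)
    shellingType₂≤₁ = subst (_≤ ∣ lookup Fs r ∣) (sym shellingType-restriction)
      (Sub.p⊆q⇒∣p∣≤∣q∣ restriction⊆F)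

  module _ (φ : ℕ → ℤ) where

    contribution : Fin (length Fs) → ℤ
    contribution r = let k , i = shellingType Fs r in interval φ (k ∸ i) i

    generatedSum : ℕ → ℤ
    generatedSum m = ∑ (subsets v) (λ G → any? (G Sub.⊆?_) (take m Fs) ▹ φ ∣ G ∣)

    generatedSum-suc : ∀ r → generatedSum (suc (toℕ r)) ≡ generatedSum (toℕ r) + contribution r
    generatedSum-suc r = begin
      generatedSum (suc (toℕ r))
        ≡⟨ ∑-adjoin φ (λ G → any? (G Sub.⊆?_) (take (toℕ r) Fs))
             (λ G → any? (G Sub.⊆?_) (take (suc (toℕ r)) Fs))
             (restriction r) (lookup Fs r) (restriction⊆F r) adjoined (𝓛⇔⊉restriction r) ⟩
      generatedSum (toℕ r) + interval φ (∣ lookup Fs r ∣ ∸ ∣ restriction r ∣) ∣ restriction r ∣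
        ≡⟨ cong (λ i → generatedSum (toℕ r) + interval φ (∣ lookup Fs r ∣ ∸ i) i)
             (shellingType-restriction r) ⟨
      generatedSum (toℕ r) + contribution r ∎
      where
      adjoined : ∀ G → Any (G ⊆_) (take (suc (toℕ r)) Fs) ⇔
                     (Any (G ⊆_) (take (toℕ r) Fs) ⊎ G ⊆ lookup Fs r)
      adjoined G rewrite List.take-suc Fs r = mk⇔ split join
        where
        split : Any (G ⊆_) (take (toℕ r) Fs ++ lookup Fs r ∷ []) →
                Any (G ⊆_) (take (toℕ r) Fs) ⊎ G ⊆ lookup Fs r
        split any with Any.++⁻ (take (toℕ r) Fs) any
        ... | inj₁ earlier    = inj₁ earlier
        ... | inj₂ (here G⊆F) = inj₂ G⊆F
        join : Any (G ⊆_) (take (toℕ r) Fs) ⊎ G ⊆ lookup Fs r →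
               Any (G ⊆_) (take (toℕ r) Fs ++ lookup Fs r ∷ [])
        join (inj₁ earlier) = Any.++⁺ˡ earlier
        join (inj₂ G⊆F)     = Any.++⁺ʳ (take (toℕ r) Fs) (here G⊆F)

    ∑-faces : ∑ (faces Δ) (φ ∘ ∣_∣) ≡ ∑ (allFin (length Fs)) contribution
    ∑-faces = begin
      ∑ (faces Δ) (φ ∘ ∣_∣)
        ≡⟨ ∑-filter (Face? Δ) (subsets v) _ ⟩
      ∑ (subsets v) (λ G → Face? Δ G ▹ φ ∣ G ∣)
        ≡⟨ ∑-cong (subsets v) (λ G → ▹-⇔ (face⇔below-facet G) (Face? Δ G) (any? (G Sub.⊆?_) Fs)) ⟩
      ∑ (subsets v) (λ G → any? (G Sub.⊆?_) Fs ▹ φ ∣ G ∣)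
        ≡⟨ cong (λ Gs → ∑ (subsets v) (λ G → any? (G Sub.⊆?_) Gs ▹ φ ∣ G ∣))
             (List.take-all (length Fs) Fs ℕ.≤-refl) ⟨
      generatedSum (length Fs)
        ≡⟨ ∑-telescope (length Fs) generatedSum contribution generatedSum-suc ⟩
      generatedSum 0 + ∑ (allFin (length Fs)) contribution
        ≡⟨ cong (_+ ∑ (allFin (length Fs)) contribution) (∑-zero (subsets v) λ _ → refl) ⟩
      0ℤ + ∑ (allFin (length Fs)) contribution
        ≡⟨ ℤ.+-identityˡ _ ⟩
      ∑ (allFin (length Fs)) contribution ∎

  -- Every facet contributes to exactly one entry of the h-triangle.
  ∑-by-type : ∀ {n} (ψ : ℕ → ℕ → ℤ) → dim Δ ℤ.< + n →
    ∑ (allFin (length Fs)) (λ r → let k , i = shellingType Fs r in ψ k i) ≡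
    ∑ (allFin (suc n)) (λ k → ∑ (allFin (suc (toℕ k))) (λ i →
      + h Fs (toℕ k) (toℕ i) * ψ (toℕ k) (toℕ i)))
  ∑-by-type {n} ψ dim<n = sym (begin
    ∑ ks (λ k → ∑ (is k) (λ i → + h Fs (toℕ k) (toℕ i) * ψ (toℕ k) (toℕ i)))
      ≡⟨ ∑-cong ks (λ k → ∑-cong (is k) (λ i → expand (toℕ k) (toℕ i))) ⟩
    ∑ ks (λ k → ∑ (is k) (λ i → ∑ rs (λ r → term r (toℕ k) (toℕ i))))
      ≡⟨ ∑-cong ks (λ k → ∑-swap (is k) rs _) ⟩
    ∑ ks (λ k → ∑ rs (λ r → ∑ (is k) (λ i → term r (toℕ k) (toℕ i))))
      ≡⟨ ∑-swap ks rs _ ⟩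
    ∑ rs (λ r → ∑ ks (λ k → ∑ (is k) (λ i → term r (toℕ k) (toℕ i))))
      ≡⟨ ∑-cong rs collapse ⟩
    ∑ rs (λ r → ψ (size r) (type r)) ∎)
    where
    ks   = allFin (suc n)
    rs   = allFin (length Fs)
    is   = λ (k : Fin (suc n)) → allFin (suc (toℕ k))
    size = proj₁ ∘ shellingType Fs
    type = proj₂ ∘ shellingType Fs

    term : Fin (length Fs) → ℕ → ℕ → ℤ
    term r k i = (size r ℕ.≟ k) ▹ (type r ℕ.≟ i) ▹ ψ k i

    has-type? : ∀ k i → Decidable (λ r → shellingType Fs r ≡ (k , i))
    has-type? k i r = ×-≡-dec ℕ._≟_ ℕ._≟_ (shellingType Fs r) (k , i)

    expand : ∀ k i → + h Fs k i * ψ k i ≡ ∑ rs (λ r → term r k i)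
    expand k i = begin
      + h Fs k i * ψ k i
        ≡⟨ cong (_* ψ k i) (trans (sym (∑-length (filter (has-type? k i) rs)))
                                   (∑-filter (has-type? k i) rs _)) ⟩
      ∑ rs (λ r → has-type? k i r ▹ 1ℤ) * ψ k i
        ≡⟨ ∑-*ʳ rs (ψ k i) _ ⟨
      ∑ rs (λ r → (has-type? k i r ▹ 1ℤ) * ψ k i)
        ≡⟨ ∑-cong rs (λ r → trans (sym (▹-*ʳ (has-type? k i r) 1ℤ (ψ k i)))
             (cong (has-type? k i r ▹_) (ℤ.*-identityˡ (ψ k i)))) ⟩
      ∑ rs (λ r → has-type? k i r ▹ ψ k i)
        ≡⟨ ∑-cong rs (λ r → trans
             (▹-⇔ (mk⇔ (λ eq → cong proj₁ eq , cong proj₂ eq) (λ (eq₁ , eq₂) → cong₂ _,_ eq₁ eq₂))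
                  (has-type? k i r) ((size r ℕ.≟ k) ×-dec (type r ℕ.≟ i)))
             (▹-× (size r ℕ.≟ k) (type r ℕ.≟ i))) ⟩
      ∑ rs (λ r → term r k i) ∎

    collapse : ∀ r → ∑ ks (λ k → ∑ (is k) (λ i → term r (toℕ k) (toℕ i))) ≡ ψ (size r) (type r)
    collapse r = begin
      ∑ ks (λ k → ∑ (is k) (λ i → term r (toℕ k) (toℕ i)))
        ≡⟨ ∑-cong ks (λ k → trans (∑-▹ (size r ℕ.≟ toℕ k) (is k) _)
             -- The bound `type r ≤ k` holds only under the guard `size r ≡ k`, so the inner sum is
             -- evaluated beneath it.
             (▹-cong (size r ℕ.≟ toℕ k) λ size≡k →
               ∑-allFin-δ (ψ (toℕ k)) (subst (type r ≤_) size≡k (shellingType₂≤₁ r)))) ⟩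
      ∑ ks (λ k → (size r ℕ.≟ toℕ k) ▹ ψ (toℕ k) (type r))
        ≡⟨ ∑-allFin-δ (λ k → ψ k (type r)) (face-size Δ dim<n (facet-face (∈-lookup r))) ⟩
      ψ (size r) (type r) ∎

-- Comparison of the two sides, coefficient by coefficient

coeff-Σ : ∀ m (f : Fin (suc m) → Poly) w → coeff (Σ[0≤ m ] f) w ≡
  ∑ (allFin (suc m)) (λ i → coeff (f i) w)
coeff-Σ m f w = trans (coeff-sumᵖ (map f (allFin (suc m))) w)
  (∑-map f (allFin (suc m)) (λ p → coeff p w))

theorem14p3 : ∀ {v} (Δ : SimplicialComplex v) (n : ℕ) (1≤n : 1 ≤ n) (dim<n : dim Δ ℤ.< + n) →
    (Fs : List (Subset v)) → IsShellingOrder Δ Fs →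
    Ψ-Semi Δ n 1≤n dim<n
      ≈ Σ[0≤ n ] (λ k → Σ[0≤ toℕ k ] (λ i →
          + h Fs (toℕ k) (toℕ i) · Φ̌ n (toℕ k) i 1≤n (toℕ≤pred[n] k)))
theorem14p3 Δ n 1≤n dim<n Fs shelled w = begin
  coeff (Ψ-Semi Δ n 1≤n dim<n) w
    ≡⟨ coeff-Ψ-Semi Δ n 1≤n dim<n w ⟩
  ∑ (SimplicialComplex.faces Δ) (λ H → faceSeries n ∣ H ∣ w)
    ≡⟨ ∑-faces (λ t → faceSeries n t w) ⟩
  ∑ (allFin (length Fs)) (λ r → let k , i = shellingType Fs r in ψ k i)
    ≡⟨ ∑-by-type ψ dim<n ⟩
  ∑ (allFin (suc n)) (λ k → ∑ (allFin (suc (toℕ k))) (λ i →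
    + h Fs (toℕ k) (toℕ i) * ψ (toℕ k) (toℕ i)))
    ≡⟨ ∑-cong (allFin (suc n)) (λ k → trans (coeff-Σ (toℕ k) (term k) w)
         (∑-cong (allFin (suc (toℕ k))) (coeff-summand k))) ⟨
  ∑ (allFin (suc n)) (λ k → coeff (Σ[0≤ toℕ k ] (term k)) w)
    ≡⟨ coeff-Σ n (λ k → Σ[0≤ toℕ k ] (term k)) w ⟨
  coeff (Σ[0≤ n ] (λ k → Σ[0≤ toℕ k ] (term k))) w ∎
  where
  open Shelling Δ Fs shelled

  ψ : ℕ → ℕ → ℤ
  ψ k i = interval (λ t → faceSeries n t w) (k ∸ i) i

  Φ̌ₖ : (k : Fin (suc n)) → Fin (suc (toℕ k)) → Poly
  Φ̌ₖ k i = Φ̌ n (toℕ k) i 1≤n (toℕ≤pred[n] k)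

  term : (k : Fin (suc n)) → Fin (suc (toℕ k)) → Poly
  term k i = + h Fs (toℕ k) (toℕ i) · Φ̌ₖ k i

  coeff-summand : ∀ k i → coeff (term k i) w ≡ + h Fs (toℕ k) (toℕ i) * ψ (toℕ k) (toℕ i)
  coeff-summand k i = trans (coeff-· (+ h Fs (toℕ k) (toℕ i)) (Φ̌ₖ k i) w)
    (cong (+ h Fs (toℕ k) (toℕ i) *_) (coeff-Φ̌ n (toℕ k) i 1≤n (toℕ≤pred[n] k) w))
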